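{- Let $n$ be a positive integer. The chambers of the resonance arrangement $\mathcal{R}_n$ can be labeled by cliques in the compatibility graph $\Gamma_{n+1}$, and the Kostant chambers can be labeled by cliques in $\Gamma_{n+1}^+$; moreover, the chambers of $\mathcal{R}_n$ are in bijection with a subset of the maximal cliques of $\Gamma_{n+1}$. Precisely: (a) For each chamber $R$ of $\mathcal{R}_n$, the set $\mathbf{T}(R)$ of all alternating trees $T$ on $[n+1]$ with $R\subseteq\mathcal{C}(T)$ is a clique in $\Gamma_{n+1}$, and the map $R\mapsto\mathbf{T}(R)$ is injective. (b) For each Kostant chamber $K\in\mathcal{K}_n$, the set $\mathbf{T}^+(K)$ of all positive alternating trees $T$ on $[n+1]$ with $K\subseteq\mathcal{C}(T)$ is a clique in $\Gamma_{n+1}^+$, and the map $K\mapsto\mathbf{T}^+(K)$ is injective. (c) For each chamber $R$ of $\mathcal{R}_n$, the clique $\mathbf{T}(R)$ is a maximal clique of $\Gamma_{n+1}$; thus $R\mapsto\mathbf{T}(R)$ is a bijection from the chambers of $\mathcal{R}_n$ onto a subset of the maximal cliques of $\Gamma_{n+1}$.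
   Context: Put $m=n+1$, $[m]=\{1,\dots,m\}$, let $e_1,\dots,e_m$ be the standard basis of $\mathbb{R}^m$, and $V_\emptyset=\{\mathbf{x}\in\mathbb{R}^m:\sum_i x_i=0\}$. Resonance arrangement: $\mathcal{R}_{n}$ is the arrangement in $V_\emptyset$ of the hyperplanes $\{\mathbf{x}\in V_\emptyset:\sum_{i\in S}x_i=0\}$ for $\emptyset\neq S\subsetneq[m]$; its chambers are the connected components of the complement in $V_\emptyset$ of their union. An alternating tree on $[m]$ is a directed graph $T$ on vertex set $[m]$ whose underlying undirected graph is a tree and in which each vertex is either a source (all incident arcs outgoing) or a sink (all incident arcs incoming). It is positive if all its arcs $(i,j)$ satisfy $i<j$. Its root cone is $\mathcal{C}(T)=\{\sum_{(i,j)\in E(T)}f(i,j)(e_i-e_j): f(i,j)\geq0\}\subset V_\emptyset$. For $I\subseteq[m]$, let $\mathrm{in}(T_I)=\{(j,i)\in E(T):i\in I,j\notin I\}$ and $\mathrm{out}(T_I)=\{(i,j)\in E(T):i\in I,j\notin I\}$. For $\emptyset\ne S\subseteq[m-1]$ put $\sigma_S(T)=+$ if $\mathrm{in}(T_S)=\emptyset$, $\sigma_S(T)=-$ if $\mathrm{out}(T_S)=\emptyset$, and $\sigma_S(T)=\,?$ otherwise. Alternating trees $T,T'$ on $[m]$ are sign incompatible if $\{\sigma_I(T),\sigma_I(T')\}=\{+,-\}$ for some $\emptyset\ne I\subseteq[m-1]$, and sign compatible otherwise. The compatibility graph $\Gamma_m$ has as vertices all alternating trees on $[m]$, two distinct trees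 being adjacent iff they are sign compatible. $\Gamma_m^+$ is its induced subgraph on the positive alternating trees. A clique is a set of pairwise adjacent vertices; it is maximal if it is not properly contained in another clique. Kostant chambers: given a collection of cones whose intersection is full-dimensional in $V_\emptyset$, the interior (in $V_\emptyset$) of the intersection is called a refined chamber; a maximally refined chamber is a refined chamber that does not contain any other refined chamber. The set $\mathcal{K}_n$ of Kostant chambers is the set of maximally refined chambers obtained from intersections of root cones $\mathcal{C}(T)$ of positive alternating trees $T$ on $[n+1]$. -}

module Defs where

open import Algebra.Bundles using (CommutativeRing)
open import Data.Bool using (if_then_else_)
open import Data.Fin using (Fin; zero; suc; inject₁; fromℕ; _≟_; _<_)
open import Data.Fin.Properties using (any?)
open import Data.Fin.Subset using (Subset; ⊤; _∈_; _∉_; _⊂_; Nonempty)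
open import Data.Fin.Subset.Properties using (_∈?_)
open import Data.Maybe using (Maybe; just; nothing)
open import Data.Nat using (ℕ; suc)
open import Data.Product using (Σ; ∃; ∃-syntax; _×_; _,_; proj₁; proj₂)
open import Data.Sign as Sign using (Sign)
open import Data.Sum using (_⊎_)
open import Data.Vec using (Vec; lookup)
open import Data.Vec.Functional using (Vector)
open import Function.Definitions using (Injective)
open import Level using (Level; 0ℓ; _⊔_) renaming (suc to lsuc)
open import Relation.Binary using (Rel; IsTotalOrder; Setoid)
open import Relation.Binary.Construct.Closure.Equivalence using (EqClosure)
open import Relation.Binary.Construct.Closure.Symmetric using (SymClosure)
open import Relation.Binary.PropositionalEquality using (_≡_; _≢_)
open import Relation.Nullary using (¬_; Dec; does)
open import Relation.Nullary.Decidable using (map′; ¬?; _×-dec_)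
open import Relation.Unary using (Pred; Decidable; Empty; _∩_; _∪_; _≬_; _≐_; Satisfiable)
  renaming (_⊆_ to _⊑_)
open import Relation.Unary.Properties using (≐-refl; ≐-sym; ≐-trans)

private variable
  ℓ : Level
  A : Set
  m n : ℕ

-- A set of subsets, equality being extensional equality.
Subsets : Pred (Pred A 0ℓ) ℓ → Setoid (lsuc 0ℓ ⊔ ℓ) 0ℓ
Subsets 𝒫 = record
  { Carrier       = ∃ 𝒫
  ; _≈_           = λ P Q → proj₁ P ≐ proj₁ Q
  ; isEquivalence = record { refl = ≐-refl ; sym = ≐-sym ; trans = ≐-trans }
  }

------------------------------------------------------------------------
-- Graphs and cliques

record Graph (A : Set) : Set₁ where
  field
    Vertex   : Pred A 0ℓ
    Adjacent : Rel A 0ℓ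

induced : Graph A → Pred A 0ℓ → Graph A
induced G P = record { Vertex = Vertex ∩ P ; Adjacent = Adjacent }
  where open Graph G

module _ (G : Graph A) where
  open Graph G

  IsClique : Pred (Pred A 0ℓ) 0ℓ
  IsClique Q = Q ⊑ Vertex × (∀ {x y} → Q x → Q y → x ≢ y → Adjacent x y)

  IsMaximalClique : Pred (Pred A 0ℓ) (lsuc 0ℓ)
  IsMaximalClique Q = IsClique Q × (∀ Q′ → IsClique Q′ → Q ⊑ Q′ → Q′ ⊑ Q)

------------------------------------------------------------------------
-- Alternating trees

-- The i-th entry is the set of heads of the arcs with tail i.
Digraph : ℕ → Set
Digraph m = Vec (Subset m) m

Arc : Digraph m → Rel (Fin m) 0ℓ
Arc T i j = j ∈ lookup T i

arc? : (T : Digraph m) (i j : Fin m) → Dec (Arc T i j)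
arc? T i j = j ∈? lookup T i

Edge : Digraph m → Rel (Fin m) 0ℓ
Edge T = SymClosure (Arc T)

Connected : Digraph m → Set
Connected T = ∀ i j → EqClosure (Arc T) i j

Cycle : Digraph m → Set
Cycle {m} T = ∃[ k ] Σ (Fin (suc (suc (suc k))) → Fin m) λ v →
  Injective _≡_ _≡_ v ×
  (∀ i → Edge T (v (inject₁ i)) (v (suc i))) ×
  Edge T (v (fromℕ _)) (v zero)

IsSource IsSink : Digraph m → Pred (Fin m) 0ℓ
IsSource T i = ∀ j → ¬ Arc T j i
IsSink   T i = ∀ j → ¬ Arc T i j

-- Loops and pairs of opposite arcs are excluded by `alternating`.
record IsAlternatingTree (T : Digraph m) : Set where
  field
    connected   : Connected T
    acyclic     : ¬ Cycle T
    alternating : ∀ i → IsSource T i ⊎ IsSink T i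

IsPositive : Pred (Digraph m) 0ℓ
IsPositive T = ∀ {i j} → Arc T i j → i < j

------------------------------------------------------------------------
-- Signs and the compatibility graph

inArcs outArcs : Digraph m → Subset m → Pred (Fin m × Fin m) 0ℓ
inArcs  T I (j , i) = Arc T j i × i ∈ I × j ∉ I
outArcs T I (i , j) = Arc T i j × i ∈ I × j ∉ I

inArcs? : (T : Digraph m) (I : Subset m) → Decidable (inArcs T I)
inArcs? T I (j , i) = arc? T j i ×-dec (i ∈? I) ×-dec ¬? (j ∈? I)

outArcs? : (T : Digraph m) (I : Subset m) → Decidable (outArcs T I)
outArcs? T I (i , j) = arc? T i j ×-dec (i ∈? I) ×-dec ¬? (j ∈? I)

empty? : {P : Pred (Fin m × Fin m) 0ℓ} → Decidable P → Dec (Empty P)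
empty? P? = map′ (λ ¬p (i , j) p → ¬p (i , j , p)) (λ e ijp → e _ (proj₂ (proj₂ ijp)))
  (¬? (any? λ i → any? λ j → P? (i , j)))

-- `nothing` is the sign "?".
σ : Subset m → Digraph m → Maybe Sign
σ I T =
  if does (empty? (inArcs? T I)) then just Sign.+ else
  if does (empty? (outArcs? T I)) then just Sign.- else nothing

-- With m = n + 1, the subsets of [m - 1] are the subsets of [m] that omit
-- the last element `fromℕ n`.
SignIncompatible : Rel (Digraph (suc n)) 0ℓ
SignIncompatible {n} T T′ = ∃[ I ] Nonempty I × fromℕ n ∉ I ×
  ((σ I T ≡ just Sign.+ × σ I T′ ≡ just Sign.-) ⊎ (σ I T ≡ just Sign.- × σ I T′ ≡ just Sign.+))

-- The compatibility graphs on the vertex set [n + 1].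
Γ Γ⁺ : ∀ n → Graph (Digraph (suc n))
Γ n = record
  { Vertex   = IsAlternatingTree
  ; Adjacent = λ T T′ → T ≢ T′ × ¬ SignIncompatible T T′
  }
Γ⁺ n = induced (Γ n) IsPositive

------------------------------------------------------------------------
-- Real numbers

-- The axioms characterising ℝ up to isomorphism. Equality is a setoid
-- equality, so that quotient-free constructions of ℝ are models.
record CompleteOrderedField : Set₁ where
  field
    commutativeRing : CommutativeRing 0ℓ 0ℓ

  open CommutativeRing commutativeRing public

  infix 4 _≤_ _≺_
  field
    _≤_          : Rel Carrier 0ℓ
    isTotalOrder : IsTotalOrder _≈_ _≤_
    0≉1          : ¬ 0# ≈ 1#
    inverse      : ∀ x → ¬ x ≈ 0# → ∃[ y ] x * y ≈ 1#
    +-monoˡ-≤    : ∀ {x y} z → x ≤ y → x + z ≤ y + z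
    *-nonneg     : ∀ {x y} → 0# ≤ x → 0# ≤ y → 0# ≤ x * y

  UpperBound : Pred Carrier 0ℓ → Pred Carrier 0ℓ
  UpperBound P b = ∀ x → P x → x ≤ b

  field
    supremum : ∀ (P : Pred Carrier 0ℓ) → ∃ P → ∃ (UpperBound P) →
               ∃[ s ] UpperBound P s × (∀ b → UpperBound P b → s ≤ b)

  _≺_ : Rel Carrier 0ℓ
  x ≺ y = x ≤ y × ¬ x ≈ y

------------------------------------------------------------------------
-- Resonance chambers and Kostant chambers

module Geometry (ℝ : CompleteOrderedField) where
  open CompleteOrderedField ℝ hiding (zero)
  open import Algebra.Properties.CommutativeMonoid.Sum +-commutativeMonoid
    using (sum; sum-syntax) public

  Point : ℕ → Set
  Point m = Vector Carrier m

  e : Fin m → Point m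
  e i k = if does (i ≟ k) then 1# else 0#

  V∅ : Pred (Point m) 0ℓ
  V∅ x = sum x ≈ 0#

  -- The cube neighbourhoods form a base of the usual topology of ℝᵐ.
  Cube : Point m → Carrier → Pred (Point m) 0ℓ
  Cube x ε y = ∀ i → x i - ε ≺ y i × y i ≺ x i + ε

  IsOpen : Pred (Pred (Point m) 0ℓ) 0ℓ
  IsOpen U = ∀ {x} → U x → ∃[ ε ] 0# ≺ ε × Cube x ε ⊑ U

  interior : Pred (Point m) 0ℓ → Pred (Point m) 0ℓ
  interior X x = V∅ x × (∃[ ε ] 0# ≺ ε × (V∅ ∩ Cube x ε) ⊑ X)

  IsConnected : Pred (Pred (Point m) 0ℓ) (lsuc 0ℓ)
  IsConnected X = ∀ U W → IsOpen U → IsOpen W →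
    X ⊑ (U ∪ W) → X ≬ U → X ≬ W → X ≬ (U ∩ W)

  IsComponentOf : Pred (Point m) 0ℓ → Pred (Pred (Point m) 0ℓ) (lsuc 0ℓ)
  IsComponentOf Y X = Satisfiable X × X ⊑ Y × IsConnected X ×
    (∀ X′ → X′ ⊑ Y → IsConnected X′ → X ⊑ X′ → X′ ⊑ X)

  sumOver : Subset m → Point m → Carrier
  sumOver {m} S x = ∑[ i < m ] (if does (i ∈? S) then x i else 0#)

  Hyperplane : Subset m → Pred (Point m) 0ℓ
  Hyperplane S x = V∅ x × sumOver S x ≈ 0#

  resonanceComplement : Pred (Point m) 0ℓ
  resonanceComplement x =
    V∅ x × ¬ (∃[ S ] Nonempty S × S ⊂ ⊤ × Hyperplane S x)

  IsChamber : ∀ n → Pred (Pred (Point (suc n)) 0ℓ) (lsuc 0ℓ)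
  IsChamber n = IsComponentOf resonanceComplement

  rootCone : Digraph m → Pred (Point m) 0ℓ
  rootCone {m} T x = Σ (Fin m → Fin m → Carrier) λ f →
    (∀ {i j} → Arc T i j → 0# ≤ f i j) ×
    (∀ k → x k ≈ ∑[ i < m ] ∑[ j < m ]
      (if does (arc? T i j) then f i j * (e i k - e j k) else 0#))

  coneIntersection : Pred (Digraph m) 0ℓ → Pred (Point m) 0ℓ
  coneIntersection 𝒮 x = V∅ x × (∀ T → 𝒮 T → rootCone T x)

  affineHull : Pred (Point m) 0ℓ → Pred (Point m) 0ℓ
  affineHull X v = ∃[ k ] Σ (Fin k → Point _) λ a → Σ (Vector Carrier k) λ c →
    (∀ j → X (a j)) × sum c ≈ 1# × (∀ i → v i ≈ ∑[ j < k ] (c j * a j i))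

  IsFullDimensional : Pred (Pred (Point m) 0ℓ) 0ℓ
  IsFullDimensional X = V∅ ⊑ affineHull X

  IsRefinedChamber : Pred (Pred (Point m) 0ℓ) (lsuc 0ℓ)
  IsRefinedChamber K = ∃[ 𝒮 ] 𝒮 ⊑ (IsAlternatingTree ∩ IsPositive) ×
    IsFullDimensional (coneIntersection 𝒮) × K ≐ interior (coneIntersection 𝒮)

  IsKostantChamber : ∀ n → Pred (Pred (Point (suc n)) 0ℓ) (lsuc 0ℓ)
  IsKostantChamber n K = IsRefinedChamber K ×
    (∀ K′ → IsRefinedChamber K′ → K′ ⊑ K → K ⊑ K′)

  𝐓 𝐓⁺ : Pred (Point m) 0ℓ → Pred (Digraph m) 0ℓ
  𝐓  R T = IsAlternatingTree T × R ⊑ rootCone T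
  𝐓⁺ K T = (IsAlternatingTree T × IsPositive T) × K ⊑ rootCone T

{-# OPTIONS --safe #-}
module Submission where

-- A generic point x is controlled by the signs of the partial sums x_S = ∑_{i ∈ S} x_i.
-- Removing an arc (a , b) from an alternating tree T leaves two components; x ∈ C(T) iff x ∈ V∅ and x_I ≥ 0
-- for the component I of a, for every arc (a , b), because a flow along T with boundary x carries x_I along (a , b).
-- Moreover x ∈ C(T) forces x_S ≥ 0 if σ_S(T) = + and x_S ≤ 0 if σ_S(T) = −, so trees whose cones share a
-- generic point are compatible.
-- Conversely, if x is generic with x_S > 0, then x is the boundary of a nonnegative flow from {x_i > 0} to
-- {x_j < 0} that never enters S.  Cancelling cycles makes its support acyclic, and genericity makes the support
-- connected: x lies in the cone of an alternating tree T with σ_S(T) = +.  These separating trees give both the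
-- injectivity of 𝐓 (chambers are sign cells) and the maximality of the cliques 𝐓(R).
-- For Kostant chambers injectivity is formal; that they are nonempty follows by summing, over the finitely many
-- inequalities that define the cone intersection, points at which the individual inequalities are strict.

open import Defs
open import Algebra.Bundles using (CommutativeRing; RawRing)
import Algebra.Solver.Ring as RingSolver
open import Algebra.Solver.Ring.AlmostCommutativeRing
  using (fromCommutativeRing; _-Raw-AlmostCommutative⟶_)
open import Axiom.ExcludedMiddle using (ExcludedMiddle)
open import Data.Bool using (if_then_else_; true)
open import Data.Empty using (⊥)
open import Data.Fin using (Fin; zero; suc; _≟_; inject₁; fromℕ; combine; remQuot)
open import Data.Fin.Properties using (any?; fromℕ≢inject₁; remQuot-combine; suc-injective)
open import Data.Fin.Subset using (Subset; _∈_; _∉_; ∁; ∣_∣; inside; outside)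
open import Data.Fin.Subset.Properties
  using (_∈?_; ∈⊤; ⊆⊤; x∈p⇒x∉∁p; x∉∁p⇒x∈p; x∉p⇒x∈∁p; x∈∁p⇒x∉p; p⊆q⇒∣p∣≤∣q∣; p⊂q⇒∣p∣<∣q∣)
open import Data.Maybe using (Maybe; just; nothing)
open import Data.Nat as ℕ using (ℕ; NonZero; zero; suc)
open import Data.Nat.Induction using (<-wellFounded)
import Data.Nat.Properties as ℕ
open import Algebra.Properties.CommutativeMonoid.Sum ℕ.+-0-commutativeMonoid using () renaming (sum to ∑ℕ)
open import Data.Product using (Σ; Σ-syntax; ∃; ∃-syntax; _×_; _,_; proj₁; proj₂; uncurry)
open import Data.Sign as Sign using (Sign)
open import Data.Sum using (_⊎_; inj₁; inj₂)
open import Data.Vec using ([]; _∷_; tabulate; lookup)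
open import Data.Vec.Properties using (lookup∘tabulate; []=⇒lookup; lookup⇒[]=)
open import Function using (_∘_)
open import Function.Bundles using (Bijection)
open import Function.Definitions using (Injective)
open import Induction.WellFounded using (Acc; acc)
open import Level using (Level; 0ℓ) renaming (suc to lsuc)
open import Relation.Binary using (IsTotalOrder; Rel)
open import Relation.Binary.Construct.Closure.Equivalence as Eq using (EqClosure)
open import Relation.Binary.Construct.Closure.ReflexiveTransitive using (Star; ε; _◅_; _◅◅_)
open import Relation.Binary.Construct.Closure.Symmetric using (fwd; bwd)
open import Relation.Binary.PropositionalEquality as ≡ using (_≡_; _≢_)
open import Relation.Nullary using (¬_; Dec; yes; no; does; contradiction)
open import Relation.Unary using (Pred; Empty; Satisfiable; _≐_; _⊆_; _∩_; _≬_)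
open import Relation.Unary.Properties using (≐-refl; ≐-sym; ≐-trans)

-- The flow behind a separating tree is explicit: a rank-one matrix with entries `u i * v j` is a
-- transport plan with prescribed row and column sums, and a combination of two such plans avoids
-- every arc entering S. Identities about flows come from one pairing, `drop`, of a matrix with the
-- differences of a potential. Chambers are given as connected components, so that they are sign
-- cells has to be proved: a partial sum cannot change sign on a connected set of generic points, as
-- its two signs define disjoint open sets, and a sign cell is convex, hence connected. Completeness
-- of the field enters only in this last implication. Signs are compared only on sets that omit the
-- last vertex, whereas a cut of a tree may have that vertex on either side; the maximality argument
-- passes to the complement when necessary, which exchanges the signs. The definition of a refined
-- chamber does not exclude points on resonance hyperplanes, so there the clique property rests on
-- openness: a nonempty open subset of `V∅` lies in no hyperplane.

module OrderedField (em : ∀ ℓ → ExcludedMiddle ℓ) (ℝ : CompleteOrderedField) where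

  open CompleteOrderedField ℝ hiding (zero)
  open import Relation.Binary.Reasoning.Setoid setoid

  private variable
    ℓ : Level
    m n : ℕ
    a b c d : Carrier

  -- Ring normalisation with coefficients in ℤ, represented by the pairs (a , b) standing for a − b.
  module Solver where

    open import Algebra.Properties.Semiring.Mult.TCOptimised semiring
      using (×-homo-+; ×1-homo-*) renaming (_×_ to _·_)
    open import Algebra.Properties.Ring ring using (x[y-z]≈xy-xz; [y-z]x≈yx-zx)
    open import Algebra.Properties.AbelianGroup +-abelianGroup using (⁻¹-∙-comm; ⁻¹-anti-homo‿-; ε⁻¹≈ε)
    open import Algebra.Properties.CommutativeSemigroup
      (CommutativeRing.+-commutativeSemigroup commutativeRing) using (interchange)

    -- The solver compares normal forms syntactically, so the pairs have to be kept reduced.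
    reduce : ℕ × ℕ → ℕ × ℕ
    reduce (suc a , suc b) = reduce (a , b)
    reduce p               = p

    coefficients : RawRing 0ℓ 0ℓ
    coefficients = record
      { Carrier = ℕ × ℕ
      ; _≈_     = _≡_
      ; _+_     = λ (a , b) (c , d) → reduce (a ℕ.+ c , b ℕ.+ d)
      ; _*_     = λ (a , b) (c , d) → reduce (a ℕ.* c ℕ.+ b ℕ.* d , a ℕ.* d ℕ.+ b ℕ.* c)
      ; -_      = λ (a , b) → b , a
      ; 0#      = 0 , 0
      ; 1#      = 1 , 0
      }

    -- The clause for b = 0 makes ⟦ 0 , 0 ⟧ and ⟦ 1 , 0 ⟧ compute to 0# and 1#.
    ⟦_⟧ : ℕ × ℕ → Carrier
    ⟦ a , zero  ⟧ = a · 1#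
    ⟦ a , suc b ⟧ = a · 1# - suc b · 1#

    ⟦⟧-difference : ∀ a b → ⟦ a , b ⟧ ≈ a · 1# - b · 1#
    ⟦⟧-difference a zero    = sym (trans (+-congˡ ε⁻¹≈ε) (+-identityʳ _))
    ⟦⟧-difference a (suc b) = refl

    difference-+ : ∀ a b c d → (a + c) - (b + d) ≈ (a - b) + (c - d)
    difference-+ a b c d = trans (+-congˡ (sym (⁻¹-∙-comm b d))) (interchange a c (- b) (- d))

    -- Cross sums decide equality of formal differences; padding both sides with the other's
    -- subtrahend makes the cross sums appear.
    ⟦⟧-cong : ∀ a b c d → a ℕ.+ d ≡ c ℕ.+ b → ⟦ a , b ⟧ ≈ ⟦ c , d ⟧
    ⟦⟧-cong a b c d eq = begin
      ⟦ a , b ⟧                          ≈⟨ ⟦⟧-difference a b ⟩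
      A - B                              ≈⟨ pad A B D ⟩
      (A + D) - (B + D)                  ≈⟨ +-cong cross (-‿cong (+-comm B D)) ⟩
      (C + B) - (D + B)                  ≈⟨ pad C D B ⟨
      C - D                              ≈⟨ ⟦⟧-difference c d ⟨
      ⟦ c , d ⟧                          ∎
      where
      A B C D : Carrier
      A = a · 1#
      B = b · 1#
      C = c · 1#
      D = d · 1#
      pad : ∀ x y z → x - y ≈ (x + z) - (y + z)
      pad x y z = sym (trans (difference-+ x y z z) (trans (+-congˡ (-‿inverseʳ z)) (+-identityʳ _)))
      cross : A + D ≈ C + B
      cross = trans (sym (×-homo-+ 1# a d)) (trans (reflexive (≡.cong (_· 1#) eq)) (×-homo-+ 1# c b))

    ⟦⟧-reduce : ∀ a b → ⟦ reduce (a , b) ⟧ ≈ ⟦ a , b ⟧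
    ⟦⟧-reduce zero    b       = refl
    ⟦⟧-reduce (suc a) zero    = refl
    ⟦⟧-reduce (suc a) (suc b) = trans (⟦⟧-reduce a b) (⟦⟧-cong a b (suc a) (suc b) (ℕ.+-suc a b))

    homo-+ : ∀ p q → ⟦ RawRing._+_ coefficients p q ⟧ ≈ ⟦ p ⟧ + ⟦ q ⟧
    homo-+ (a , b) (c , d) = begin
      ⟦ reduce (a ℕ.+ c , b ℕ.+ d) ⟧
        ≈⟨ ⟦⟧-reduce (a ℕ.+ c) (b ℕ.+ d) ⟩
      ⟦ a ℕ.+ c , b ℕ.+ d ⟧
        ≈⟨ ⟦⟧-difference (a ℕ.+ c) (b ℕ.+ d) ⟩
      (a ℕ.+ c) · 1# - (b ℕ.+ d) · 1#
        ≈⟨ +-cong (×-homo-+ 1# a c) (-‿cong (×-homo-+ 1# b d)) ⟩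
      (a · 1# + c · 1#) - (b · 1# + d · 1#)
        ≈⟨ difference-+ _ _ _ _ ⟩
      (a · 1# - b · 1#) + (c · 1# - d · 1#)
        ≈⟨ +-cong (⟦⟧-difference a b) (⟦⟧-difference c d) ⟨
      ⟦ a , b ⟧ + ⟦ c , d ⟧ ∎

    homo-* : ∀ p q → ⟦ RawRing._*_ coefficients p q ⟧ ≈ ⟦ p ⟧ * ⟦ q ⟧
    homo-* (a , b) (c , d) = begin
      ⟦ reduce (a ℕ.* c ℕ.+ b ℕ.* d , a ℕ.* d ℕ.+ b ℕ.* c) ⟧
        ≈⟨ ⟦⟧-reduce (a ℕ.* c ℕ.+ b ℕ.* d) (a ℕ.* d ℕ.+ b ℕ.* c) ⟩
      ⟦ a ℕ.* c ℕ.+ b ℕ.* d , a ℕ.* d ℕ.+ b ℕ.* c ⟧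
        ≈⟨ ⟦⟧-difference (a ℕ.* c ℕ.+ b ℕ.* d) (a ℕ.* d ℕ.+ b ℕ.* c) ⟩
      (a ℕ.* c ℕ.+ b ℕ.* d) · 1# - (a ℕ.* d ℕ.+ b ℕ.* c) · 1#
        ≈⟨ +-cong (products a c b d) (-‿cong (products a d b c)) ⟩
      (A * C + B * D) - (A * D + B * C)
        ≈⟨ difference-+ _ _ _ _ ⟩
      (A * C - A * D) + (B * D - B * C)
        ≈⟨ +-cong (x[y-z]≈xy-xz A C D) (trans (-‿cong (x[y-z]≈xy-xz B C D)) (⁻¹-anti-homo‿- _ _)) ⟨
      A * (C - D) - B * (C - D)
        ≈⟨ [y-z]x≈yx-zx (C - D) A B ⟨
      (A - B) * (C - D)
        ≈⟨ *-cong (⟦⟧-difference a b) (⟦⟧-difference c d) ⟨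
      ⟦ a , b ⟧ * ⟦ c , d ⟧ ∎
      where
      A B C D : Carrier
      A = a · 1#
      B = b · 1#
      C = c · 1#
      D = d · 1#
      products : ∀ p q r s → (p ℕ.* q ℕ.+ r ℕ.* s) · 1# ≈ p · 1# * (q · 1#) + r · 1# * (s · 1#)
      products p q r s =
        trans (×-homo-+ 1# (p ℕ.* q) (r ℕ.* s)) (+-cong (×1-homo-* p q) (×1-homo-* r s))

    homo-- : ∀ p → ⟦ RawRing.-_ coefficients p ⟧ ≈ - ⟦ p ⟧
    homo-- (a , b) = begin
      ⟦ b , a ⟧              ≈⟨ ⟦⟧-difference b a ⟩
      b · 1# - a · 1#        ≈⟨ ⁻¹-anti-homo‿- _ _ ⟨
      - (a · 1# - b · 1#)    ≈⟨ -‿cong (⟦⟧-difference a b) ⟨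
      - ⟦ a , b ⟧            ∎

    morphism : coefficients -Raw-AlmostCommutative⟶ fromCommutativeRing commutativeRing
    morphism = record
      { ⟦_⟧    = ⟦_⟧
      ; +-homo = homo-+
      ; *-homo = homo-*
      ; -‿homo = homo--
      ; 0-homo = refl
      ; 1-homo = refl
      }

    weaklyDecide : (p q : ℕ × ℕ) → Maybe (⟦ p ⟧ ≈ ⟦ q ⟧)
    weaklyDecide (a , b) (c , d) with a ℕ.+ d ℕ.≟ c ℕ.+ b
    ... | yes eq = just (⟦⟧-cong a b c d eq)
    ... | no  _  = nothing

    open RingSolver coefficients (fromCommutativeRing commutativeRing) morphism weaklyDecide public
      using (solve; _:=_; con; _:+_; _:*_; _:-_; :-_)

  open Solver public using (solve; _:=_; con; _:+_; _:*_; _:-_; :-_)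

  -- Arithmetic of inequalities

  decide : (P : Set ℓ) → Dec P
  decide P = em _

  by-contradiction : {P : Set ℓ} → ¬ ¬ P → P
  by-contradiction {P = P} ¬¬p with decide P
  ... | yes p = p
  ... | no ¬p = contradiction ¬p ¬¬p

  module ≤ = IsTotalOrder isTotalOrder

  ≤-resp : a ≈ b → c ≈ d → a ≤ c → b ≤ d
  ≤-resp p q r = ≤.trans (≤.reflexive (sym p)) (≤.trans r (≤.reflexive q))

  nonneg-resp : a ≈ b → 0# ≤ a → 0# ≤ b
  nonneg-resp = ≤-resp refl

  -- Together with `nonneg⇒≤` this brings inequalities into the form `0# ≤ _`, where the ring solver
  -- can match the difference with sums and products of nonnegative terms.
  ≤⇒nonneg : a ≤ b → 0# ≤ b - a
  ≤⇒nonneg {a} r = ≤-resp (-‿inverseʳ a) refl (+-monoˡ-≤ (- a) r)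

  nonneg⇒≤ : 0# ≤ b - a → a ≤ b
  nonneg⇒≤ {b} {a} r = ≤-resp (+-identityˡ a)
    (solve 2 (λ a b → (b :- a) :+ a := b) refl a b) (+-monoˡ-≤ a r)

  nonneg-+ : 0# ≤ a → 0# ≤ b → 0# ≤ a + b
  nonneg-+ {a} {b} p q = ≤.trans q (≤-resp (+-identityˡ b) refl (+-monoˡ-≤ b p))

  ≤-nonneg⁻¹ : 0# ≤ a → 0# ≤ - a → a ≈ 0#
  ≤-nonneg⁻¹ {a} p q = ≤.antisym (nonneg⇒≤ (nonneg-resp (sym (+-identityˡ (- a))) q)) p

  pos-resp : a ≈ b → 0# ≺ a → 0# ≺ b
  pos-resp p (r , s) = nonneg-resp p r , λ t → s (trans t (sym p))

  ≺⇒pos : a ≺ b → 0# ≺ b - a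
  ≺⇒pos {a} {b} (r , s) = ≤⇒nonneg r , λ t → s (begin
    a             ≈⟨ +-identityˡ a ⟨
    0# + a        ≈⟨ +-congʳ t ⟩
    (b - a) + a   ≈⟨ solve 2 (λ a b → (b :- a) :+ a := b) refl a b ⟩
    b             ∎)

  pos⇒≺ : 0# ≺ b - a → a ≺ b
  pos⇒≺ {b} {a} (r , s) = nonneg⇒≤ r , λ t → s (sym (trans (+-congˡ (-‿cong t)) (-‿inverseʳ b)))

  pos-+ : 0# ≺ a → 0# ≤ b → 0# ≺ a + b
  pos-+ {a} {b} (p , q) r = nonneg-+ p r , λ s → q (sym (≤-nonneg⁻¹ p (nonneg-resp (begin
    b              ≈⟨ solve 2 (λ a b → b := (a :+ b) :- a) refl a b ⟩
    (a + b) - a    ≈⟨ +-congʳ s ⟨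
    0# - a         ≈⟨ +-identityˡ _ ⟩
    - a            ∎) r)))

  pos-nonneg⁻¹ : 0# ≺ a → ¬ 0# ≤ - a
  pos-nonneg⁻¹ (p , q) r = q (sym (≤-nonneg⁻¹ p r))

  trichotomy : ∀ x → 0# ≺ x ⊎ x ≈ 0# ⊎ 0# ≺ - x
  trichotomy x with decide (x ≈ 0#) | ≤.total 0# x
  ... | yes x≈0 | _ = inj₂ (inj₁ x≈0)
  ... | no  x≉0 | inj₁ 0≤x = inj₁ (0≤x , λ 0≈x → x≉0 (sym 0≈x))
  ... | no  x≉0 | inj₂ x≤0 = inj₂ (inj₂
    (nonneg-resp (+-identityˡ _) (≤⇒nonneg x≤0) , λ 0≈-x → x≉0 (begin
      x          ≈⟨ solve 1 (λ x → x := :- (:- x)) refl x ⟩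
      - (- x)    ≈⟨ -‿cong 0≈-x ⟨
      - 0#       ≈⟨ solve 0 (:- con (0 , 0) := con (0 , 0)) refl ⟩
      0#         ∎)))

  ¬nonneg⇒neg : ¬ 0# ≤ a → 0# ≺ - a
  ¬nonneg⇒neg {a} ¬p with trichotomy a
  ... | inj₁ (p , _)   = contradiction p ¬p
  ... | inj₂ (inj₁ p)  = contradiction (≤.reflexive (sym p)) ¬p
  ... | inj₂ (inj₂ p)  = p

  nonpos⇒nonneg-neg : a ≤ 0# → 0# ≤ - a
  nonpos⇒nonneg-neg p = nonneg-resp (+-identityˡ _) (≤⇒nonneg p)

  ¬pos⇒nonneg-neg : ¬ 0# ≺ a → 0# ≤ - a
  ¬pos⇒nonneg-neg {a} ¬p with trichotomy a
  ... | inj₁ p              = contradiction p ¬p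
  ... | inj₂ (inj₁ p)       = nonpos⇒nonneg-neg (≤.reflexive p)
  ... | inj₂ (inj₂ (p , _)) = p

  neg-involutive : ∀ x → - (- x) ≈ x
  neg-involutive = solve 1 (λ x → :- (:- x) := x) refl

  nonneg-1 : 0# ≤ 1#
  nonneg-1 with ≤.total 0# 1#
  ... | inj₁ p = p
  -- If `1# ≤ 0#`, then `- 1#` is nonnegative and so is its square `1#`.
  ... | inj₂ p = nonneg-resp (solve 0 (:- con (1 , 0) :* :- con (1 , 0) := con (1 , 0)) refl)
                   (*-nonneg (nonpos⇒nonneg-neg p) (nonpos⇒nonneg-neg p))

  pos-1 : 0# ≺ 1#
  pos-1 = nonneg-1 , 0≉1

  pos⇒≉0 : 0# ≺ a → ¬ a ≈ 0#
  pos⇒≉0 (_ , q) r = q (sym r)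

  *-cancelˡ-0 : ¬ a ≈ 0# → a * b ≈ 0# → b ≈ 0#
  *-cancelˡ-0 {a} {b} a≉0 ab≈0 with inverse a a≉0
  ... | y , ay≈1 = begin
    b              ≈⟨ *-identityˡ b ⟨
    1# * b         ≈⟨ *-congʳ ay≈1 ⟨
    (a * y) * b    ≈⟨ solve 3 (λ a y b → (a :* y) :* b := y :* (a :* b)) refl a y b ⟩
    y * (a * b)    ≈⟨ *-congˡ ab≈0 ⟩
    y * 0#         ≈⟨ zeroʳ y ⟩
    0#             ∎

  pos-* : 0# ≺ a → 0# ≺ b → 0# ≺ a * b
  pos-* p q = *-nonneg (proj₁ p) (proj₁ q) , λ s → pos⇒≉0 q (*-cancelˡ-0 (pos⇒≉0 p) (sym s))

  pos-inverse : 0# ≺ a → ∃[ y ] 0# ≺ y × a * y ≈ 1#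
  pos-inverse {a} p with inverse a (pos⇒≉0 p)
  ... | y , ay≈1 with trichotomy y
  ...   | inj₁ q        = y , q , ay≈1
  ...   | inj₂ (inj₁ q) = contradiction (trans (sym (zeroʳ a)) (trans (*-congˡ (sym q)) ay≈1)) 0≉1
  -- A negative `y` would make `a * - y ≈ - 1#` nonnegative.
  ...   | inj₂ (inj₂ q) = contradiction
    (nonneg-resp (trans (solve 2 (λ a y → a :* :- y := :- (a :* y)) refl a y) (-‿cong ay≈1))
      (proj₁ (pos-* p q)))
    (pos-nonneg⁻¹ pos-1)

  *-cancelˡ-nonneg : 0# ≺ a → 0# ≤ a * b → 0# ≤ b
  *-cancelˡ-nonneg {a} {b} p q with pos-inverse p
  ... | y , r , ay≈1 = nonneg-resp (begin
    y * (a * b)    ≈⟨ solve 3 (λ a y b → y :* (a :* b) := (a :* y) :* b) refl a y b ⟩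
    (a * y) * b    ≈⟨ *-congʳ ay≈1 ⟩
    1# * b         ≈⟨ *-identityˡ b ⟩
    b              ∎) (*-nonneg (proj₁ r) q)

  pos-minimum : 0# ≺ a → 0# ≺ b → ∃[ c ] 0# ≺ c × c ≤ a × c ≤ b
  pos-minimum {a} {b} p q with ≤.total a b
  ... | inj₁ r = a , p , ≤.refl , r
  ... | inj₂ r = b , q , r , ≤.refl

  ≤-≺-trans : a ≤ b → b ≺ c → a ≺ c
  ≤-≺-trans {a} {b} {c} p q = pos⇒≺ (pos-resp
    (solve 3 (λ a b c → (c :- b) :+ (b :- a) := c :- a) refl a b c)
    (pos-+ (≺⇒pos q) (≤⇒nonneg p)))

  -- Finite sums, indicators and sums over subsets

  open Geometry ℝ
  open import Algebra.Properties.CommutativeMonoid.Sum +-commutativeMonoid public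
    using (sum-cong-≋; ∑-distrib-+; ∑-comm)
  open import Algebra.Properties.Semiring.Sum semiring public using (*-distribˡ-sum)

  ∑-zero : (f : Fin n → Carrier) → (∀ i → f i ≈ 0#) → sum f ≈ 0#
  ∑-zero {zero}  f p = refl
  ∑-zero {suc n} f p = trans (+-cong (p zero) (∑-zero (λ i → f (suc i)) (λ i → p (suc i)))) (+-identityˡ 0#)

  ∑-single : (f : Fin n → Carrier) (i : Fin n) → (∀ j → i ≢ j → f j ≈ 0#) → sum f ≈ f i
  ∑-single f zero p = trans (+-congˡ (∑-zero (λ j → f (suc j)) (λ j → p (suc j) λ ()))) (+-identityʳ _)
  ∑-single f (suc i) p = trans
    (+-cong (p zero λ ()) (∑-single (λ j → f (suc j)) i λ j i≢j → p (suc j) λ { ≡.refl → i≢j ≡.refl }))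
    (+-identityˡ _)

  ∑-nonneg : (f : Fin n → Carrier) → (∀ i → 0# ≤ f i) → 0# ≤ sum f
  ∑-nonneg {zero}  f p = ≤.refl
  ∑-nonneg {suc n} f p = nonneg-+ (p zero) (∑-nonneg (λ i → f (suc i)) (λ i → p (suc i)))

  ∑-neg : (f : Fin n → Carrier) → sum (λ i → - f i) ≈ - sum f
  ∑-neg {zero}  f = solve 0 (con (0 , 0) := :- con (0 , 0)) refl
  ∑-neg {suc n} f = trans (+-congˡ (∑-neg (λ i → f (suc i))))
    (solve 2 (λ a b → :- a :+ :- b := :- (a :+ b)) refl (f zero) (sum (λ i → f (suc i))))

  ∑-distrib-- : (f g : Fin n → Carrier) → sum (λ i → f i - g i) ≈ sum f - sum g
  ∑-distrib-- f g = trans (∑-distrib-+ f (λ i → - g i)) (+-congˡ (∑-neg g))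

  ≤-sum : (f : Fin n → Carrier) → (∀ i → 0# ≤ f i) → ∀ i → f i ≤ sum f
  ≤-sum f p zero = nonneg⇒≤ (nonneg-resp
    (solve 2 (λ a b → b := (a :+ b) :- a) refl (f zero) _) (∑-nonneg (λ i → f (suc i)) (λ i → p (suc i))))
  ≤-sum f p (suc i) = ≤.trans (≤-sum (λ i → f (suc i)) (λ i → p (suc i)) i)
    (nonneg⇒≤ (nonneg-resp (solve 2 (λ a b → a := (a :+ b) :- b) refl (f zero) _) (p zero)))

  ∑-linear : (s t : Carrier) (f g : Fin n → Carrier) →
             sum (λ i → s * f i + t * g i) ≈ s * sum f + t * sum g
  ∑-linear s t f g = trans (∑-distrib-+ (λ i → s * f i) (λ i → t * g i))
    (sym (+-cong (*-distribˡ-sum s f) (*-distribˡ-sum t g)))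

  -- `[ i ≟ k ]` is definitionally `e i k`, so the lemmas on indicators also evaluate basis vectors.
  [_] : {P : Set ℓ} → Dec P → Carrier
  [ d ] = if does d then 1# else 0#

  []-yes : {P : Set ℓ} (d : Dec P) → P → [ d ] ≈ 1#
  []-yes (yes _) p = refl
  []-yes (no ¬p) p = contradiction p ¬p

  []-no : {P : Set ℓ} (d : Dec P) → ¬ P → [ d ] ≈ 0#
  []-no (yes p) ¬p = contradiction p ¬p
  []-no (no _)  ¬p = refl

  []-nonneg : {P : Set ℓ} (d : Dec P) → 0# ≤ [ d ]
  []-nonneg (yes _) = nonneg-1
  []-nonneg (no _)  = ≤.refl

  χ : Subset m → Fin m → Carrier
  χ S i = [ i ∈? S ]

  -- Replaces the conditional summands by products with an indicator, to which linearity of weighted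
  -- sums applies.
  sumOver-χ : (S : Subset m) (x : Point m) → sumOver S x ≈ ∑[ i < m ] (χ S i * x i)
  sumOver-χ S x = sum-cong-≋ λ i → case i
    where
    case : ∀ i → (if does (i ∈? S) then x i else 0#) ≈ χ S i * x i
    case i with i ∈? S
    ... | yes _ = sym (*-identityˡ _)
    ... | no  _ = sym (zeroˡ _)

  sumOver-cong : (S : Subset m) {x y : Point m} → (∀ i → x i ≈ y i) → sumOver S x ≈ sumOver S y
  sumOver-cong S {x} {y} p = trans (sumOver-χ S x)
    (trans (sum-cong-≋ λ i → *-congˡ (p i)) (sym (sumOver-χ S y)))

  sumOver-linear : (S : Subset m) (s t : Carrier) (x y : Point m) →
                   sumOver S (λ i → s * x i + t * y i) ≈ s * sumOver S x + t * sumOver S y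
  sumOver-linear S s t x y = begin
    sumOver S (λ i → s * x i + t * y i)
      ≈⟨ sumOver-χ S _ ⟩
    sum (λ i → χ S i * (s * x i + t * y i))
      ≈⟨ sum-cong-≋ (λ i → solve 5 (λ c s t x y → c :* (s :* x :+ t :* y) := s :* (c :* x) :+ t :* (c :* y))
           refl (χ S i) s t (x i) (y i)) ⟩
    sum (λ i → s * (χ S i * x i) + t * (χ S i * y i))
      ≈⟨ ∑-linear s t (λ i → χ S i * x i) (λ i → χ S i * y i) ⟩
    s * sum (λ i → χ S i * x i) + t * sum (λ i → χ S i * y i)
      ≈⟨ +-cong (*-congˡ (sumOver-χ S x)) (*-congˡ (sumOver-χ S y)) ⟨
    s * sumOver S x + t * sumOver S y ∎

  χ-∁ : (S : Subset m) (i : Fin m) → χ S i + χ (∁ S) i ≈ 1#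
  χ-∁ S i with i ∈? S
  ... | yes i∈S = trans (+-congˡ ([]-no (i ∈? ∁ S) (x∈p⇒x∉∁p i∈S))) (+-identityʳ _)
  ... | no  i∉S = trans (+-congˡ ([]-yes (i ∈? ∁ S) (x∉p⇒x∈∁p i∉S))) (+-identityˡ _)

  -- The indicators of S and its complement add up to 1, and the total sum vanishes on `V∅`. This
  -- reduces claims about negative signs to positive ones.
  sumOver-∁ : (S : Subset m) {x : Point m} → V∅ x → sumOver (∁ S) x ≈ - sumOver S x
  sumOver-∁ S {x} ∑x≈0 = begin
    B               ≈⟨ solve 2 (λ a b → b := (a :+ b) :- a) refl A B ⟩
    (A + B) - A     ≈⟨ +-congʳ total ⟩
    0# - A          ≈⟨ +-identityˡ _ ⟩
    - A             ∎
    where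
    A B : Carrier
    A = sumOver S x
    B = sumOver (∁ S) x
    total : A + B ≈ 0#
    total = begin
      A + B
        ≈⟨ +-cong (sumOver-χ S x) (sumOver-χ (∁ S) x) ⟩
      sum (λ i → χ S i * x i) + sum (λ i → χ (∁ S) i * x i)
        ≈⟨ ∑-distrib-+ (λ i → χ S i * x i) (λ i → χ (∁ S) i * x i) ⟨
      sum (λ i → χ S i * x i + χ (∁ S) i * x i)
        ≈⟨ sum-cong-≋ (λ i → trans (sym (distribʳ (x i) _ _)) (trans (*-congʳ (χ-∁ S i)) (*-identityˡ _))) ⟩
      sum x
        ≈⟨ ∑x≈0 ⟩
      0# ∎

  ∑-e : (i : Fin m) (φ : Fin m → Carrier) → ∑[ k < m ] (φ k * e i k) ≈ φ i
  ∑-e i φ = trans (∑-single _ i λ k i≢k → trans (*-congˡ ([]-no (i ≟ k) i≢k)) (zeroʳ _))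
    (trans (*-congˡ ([]-yes (i ≟ i) ≡.refl)) (*-identityʳ _))

  ∑-e-transposed : (k : Fin m) (φ : Fin m → Carrier) → ∑[ i < m ] (φ i * e i k) ≈ φ k
  ∑-e-transposed k φ = trans
    (∑-single _ k λ i k≢i → trans (*-congˡ ([]-no (i ≟ k) (λ i≡k → k≢i (≡.sym i≡k)))) (zeroʳ _))
    (trans (*-congˡ ([]-yes (k ≟ k) ≡.refl)) (*-identityʳ _))

  sumOver-e : (S : Subset m) (i : Fin m) → sumOver S (e i) ≈ χ S i
  sumOver-e S i = trans (sumOver-χ S (e i)) (∑-e i (χ S))

-- Paths, signs and a finite uniformity principle

private variable
  m n k : ℕ
  a b i j : Fin m
  D T : Digraph m
  S : Subset m

-- Vertices are an injective family, as in `Cycle`, so that a simple path with at least two steps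
-- and a closing edge is literally a cycle.
record SimplePath {A : Set} (R : Rel A 0ℓ) (i j : A) : Set where
  constructor simplePath
  field
    {steps}   : ℕ
    vertex    : Fin (suc steps) → A
    injective : Injective _≡_ _≡_ vertex
    adjacent  : ∀ p → R (vertex (inject₁ p)) (vertex (suc p))
    start     : vertex zero ≡ i
    end       : vertex (fromℕ steps) ≡ j

module _ {A : Set} {R : Rel A 0ℓ} where

  suffix : {i j : A} (P : SimplePath R i j) (p : Fin (suc (SimplePath.steps P))) →
           SimplePath R (SimplePath.vertex P p) j
  suffix (simplePath v inj adj _ end) zero = simplePath v inj adj ≡.refl end
  suffix (simplePath {suc _} v inj adj _ end) (suc p) =
    suffix (simplePath (v ∘ suc) (suc-injective ∘ inj) (adj ∘ suc) ≡.refl end) p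

  chain : (v : Fin (suc k) → A) → (∀ p → R (v (inject₁ p)) (v (suc p))) → Star R (v zero) (v (fromℕ k))
  chain {zero}  v adj = ε
  chain {suc k} v adj = adj zero ◅ chain (v ∘ suc) (adj ∘ suc)

simplify : {R : Rel (Fin m) 0ℓ} → Star R i j → SimplePath R i j
simplify {i = i} ε = simplePath {steps = 0} (λ _ → i) (λ { {zero} {zero} _ → ≡.refl }) (λ ()) ≡.refl ≡.refl
simplify {i = i} {R = R} (r ◅ path) with simplify path
... | P@(simplePath v inj adj start end) with any? (λ p → v p ≟ i)
-- If the new vertex already occurs on the path, the loop is cut off at that occurrence.
...   | yes (p , vp≡i) = ≡.subst (λ i → SimplePath R i _) vp≡i (suffix P p)
...   | no  v≢i = simplePath v′ inj′ adj′ ≡.refl end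
  where
  v′ : Fin _ → Fin _
  v′ zero    = i
  v′ (suc p) = v p
  inj′ : Injective _≡_ _≡_ v′
  inj′ {zero}  {zero}  _  = ≡.refl
  inj′ {zero}  {suc q} eq = contradiction (q , ≡.sym eq) v≢i
  inj′ {suc p} {zero}  eq = contradiction (p , eq) v≢i
  inj′ {suc p} {suc q} eq = ≡.cong suc (inj eq)
  adj′ : ∀ p → R (v′ (inject₁ p)) (v′ (suc p))
  adj′ zero    = ≡.subst (R i) (≡.sym start) r
  adj′ (suc p) = adj p

-- The termination measure for cancelling cycles.
arcCount : Digraph m → ℕ
arcCount {m} D = ∑ℕ λ i → ∣ lookup D i ∣

inArcs-∁ : (S : Subset m) → Empty (inArcs T (∁ S)) → Empty (outArcs T S)
inArcs-∁ S empty (i , j) (arc , i∈S , j∉S) = empty (i , j) (arc , x∉p⇒x∈∁p j∉S , x∈p⇒x∉∁p i∈S)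

module _ {P Q : Set} where

  -- `σ S T` unfolds to this with its two emptiness tests as arguments; abstracting over them
  -- permits matching on the decisions.
  signOf : Dec P → Dec Q → Maybe Sign
  signOf p? q? = if does p? then just Sign.+ else if does q? then just Sign.- else nothing

  signOf≡+ : (p? : Dec P) (q? : Dec Q) → P → signOf p? q? ≡ just Sign.+
  signOf≡+ (yes _) _ _ = ≡.refl
  signOf≡+ (no ¬p) _ p = contradiction p ¬p

  signOf≡- : (p? : Dec P) (q? : Dec Q) → ¬ P → Q → signOf p? q? ≡ just Sign.-
  signOf≡- (yes p) _       ¬p _ = contradiction p ¬p
  signOf≡- (no _)  (yes _) _  _ = ≡.refl
  signOf≡- (no _)  (no ¬q) _  q = contradiction q ¬q

  signOf≡+⁻¹ : (p? : Dec P) (q? : Dec Q) → signOf p? q? ≡ just Sign.+ → P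
  signOf≡+⁻¹ (yes p) _       _ = p
  signOf≡+⁻¹ (no _)  (yes _) ()
  signOf≡+⁻¹ (no _)  (no _)  ()

  signOf≡-⁻¹ : (p? : Dec P) (q? : Dec Q) → signOf p? q? ≡ just Sign.- → Q
  signOf≡-⁻¹ (yes _) _       ()
  signOf≡-⁻¹ (no _)  (yes q) _ = q
  signOf≡-⁻¹ (no _)  (no _)  ()

module _ (S : Subset m) (T : Digraph m) where

  private
    in? : Dec (Empty (inArcs T S))
    in? = empty? (inArcs? T S)
    out? : Dec (Empty (outArcs T S))
    out? = empty? (outArcs? T S)

  σ≡+ : Empty (inArcs T S) → σ S T ≡ just Sign.+
  σ≡+ = signOf≡+ in? out?

  -- `σ` tests the entering arcs first, so a set crossed by no arc gets the sign +; hence the first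
  -- argument.
  σ≡- : ¬ Empty (inArcs T S) → Empty (outArcs T S) → σ S T ≡ just Sign.-
  σ≡- = signOf≡- in? out?

  σ≡+⁻¹ : σ S T ≡ just Sign.+ → Empty (inArcs T S)
  σ≡+⁻¹ = signOf≡+⁻¹ in? out?

  σ≡-⁻¹ : σ S T ≡ just Sign.- → Empty (outArcs T S)
  σ≡-⁻¹ = signOf≡-⁻¹ in? out?

maximalClique-resp : {A : Set} (G : Graph A) {P Q : Pred A 0ℓ} → P ≐ Q → IsMaximalClique G P → IsMaximalClique G Q
maximalClique-resp G (P⊆Q , Q⊆P) ((P-vertices , P-adjacent) , maximal) =
  ( (λ Qx → P-vertices (Q⊆P Qx)) , λ Qx Qy → P-adjacent (Q⊆P Qx) (Q⊆P Qy)) ,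
  λ Q′ clique Q⊆Q′ Q′x → P⊆Q (maximal Q′ clique (λ Px → Q⊆Q′ (P⊆Q Px)) Q′x)

-- Induction on k: the witnesses for the subsets with and without the first element are merged by
-- directedness. It is applied to points of a cone, merged by addition, and to radii, merged by
-- minimum.
directed⇒uniform : {A : Set} (X : Pred A 0ℓ) (G : Subset k → Pred A 0ℓ) →
  (∀ {p q} → X p → X q → ∃[ r ] X r × (∀ S → G S p → G S r) × (∀ S → G S q → G S r)) →
  (∀ S → ∃[ p ] X p × G S p) → ∃[ p ] X p × (∀ S → G S p)
directed⇒uniform {zero} X G directed pointwise with pointwise []
... | p , Xp , Gp = p , Xp , λ { [] → Gp }
directed⇒uniform {suc k} X G directed pointwise
  with directed⇒uniform X (λ S → G (outside ∷ S)) (restrict outside) (λ S → pointwise (outside ∷ S))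
     | directed⇒uniform X (λ S → G (inside ∷ S)) (restrict inside) (λ S → pointwise (inside ∷ S))
  where
  restrict : ∀ s {p q} → X p → X q →
    ∃[ r ] X r × (∀ S → G (s ∷ S) p → G (s ∷ S) r) × (∀ S → G (s ∷ S) q → G (s ∷ S) r)
  restrict s Xp Xq with directed Xp Xq
  ... | r , Xr , p⇒r , q⇒r = r , Xr , (λ S → p⇒r (s ∷ S)) , (λ S → q⇒r (s ∷ S))
... | p , Xp , Gp | q , Xq , Gq with directed Xp Xq
...   | r , Xr , p⇒r , q⇒r = r , Xr , λ
  { (outside ∷ S) → p⇒r (outside ∷ S) (Gp S)
  ; (inside  ∷ S) → q⇒r (inside ∷ S) (Gq S)
  }

module Chambers (em : ∀ ℓ → ExcludedMiddle ℓ) (ℝ : CompleteOrderedField) where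

  open OrderedField em ℝ
  open CompleteOrderedField ℝ hiding (zero)
  open import Relation.Binary.Reasoning.Setoid setoid
  open Geometry ℝ

  -- Flows and their boundaries

  private variable
    x y z : Point m

  Matrix : ℕ → Set
  Matrix m = Fin m → Fin m → Carrier

  -- The pairing of `g` with the discrete gradient of the potential `φ`. The boundary `∂` is its
  -- value at the indicator potentials of single vertices.
  drop : Matrix m → (Fin m → Carrier) → Carrier
  drop {m} g φ = ∑[ i < m ] ∑[ j < m ] (g i j * (φ i - φ j))

  ∂ : Matrix m → Point m
  ∂ g k = drop g (λ i → e i k)

  drop-cong : {g h : Matrix m} (φ : Fin m → Carrier) → (∀ i j → g i j ≈ h i j) → drop g φ ≈ drop h φ
  drop-cong φ p = sum-cong-≋ λ i → sum-cong-≋ λ j → *-congʳ (p i j)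

  drop-linear : (s t : Carrier) (g h : Matrix m) (φ : Fin m → Carrier) →
                drop (λ i j → s * g i j + t * h i j) φ ≈ s * drop g φ + t * drop h φ
  drop-linear {m} s t g h φ = trans
    (sum-cong-≋ λ i → trans
      (sum-cong-≋ λ j → solve 5 (λ s t g h d → (s :* g :+ t :* h) :* d := s :* (g :* d) :+ t :* (h :* d))
        refl s t (g i j) (h i j) (φ i - φ j))
      (∑-linear s t (λ j → g i j * (φ i - φ j)) (λ j → h i j * (φ i - φ j))))
    (∑-linear s t (λ i → sum λ j → g i j * (φ i - φ j)) (λ i → sum λ j → h i j * (φ i - φ j)))

  drop-product : (u v φ : Fin m → Carrier) →
    drop (λ i j → u i * v j) φ ≈ sum v * sum (λ i → u i * φ i) + (- sum (λ j → v j * φ j)) * sum u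
  drop-product {m} u v φ = trans
    (sum-cong-≋ λ i → trans
      (sum-cong-≋ λ j → solve 4 (λ u v p q → u :* v :* (p :- q) := (u :* p) :* v :+ (:- u) :* (v :* q))
        refl (u i) (v j) (φ i) (φ j))
      (trans (∑-linear (u i * φ i) (- u i) v (λ j → v j * φ j))
        (solve 4 (λ u p s t → (u :* p) :* s :+ (:- u) :* t := s :* (u :* p) :+ (:- t) :* u)
          refl (u i) (φ i) (sum v) (sum λ j → v j * φ j))))
    (∑-linear (sum v) (- sum (λ j → v j * φ j)) (λ i → u i * φ i) u)

  -- Summation by parts: the boundary is adjoint to the discrete gradient. The vertex sum is moved
  -- innermost, where `∑-e` evaluates it.
  weightedSum-∂ : (φ : Fin m → Carrier) (g : Matrix m) → ∑[ k < m ] (φ k * ∂ g k) ≈ drop g φ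
  weightedSum-∂ {m} φ g = begin
    ∑[ k < m ] (φ k * ∂ g k)
      ≈⟨ sum-cong-≋ (λ k → trans
           (*-distribˡ-sum (φ k) (λ i → sum λ j → g i j * (e i k - e j k)))
           (sum-cong-≋ λ i → *-distribˡ-sum (φ k) (λ j → g i j * (e i k - e j k)))) ⟩
    ∑[ k < m ] ∑[ i < m ] ∑[ j < m ] (φ k * (g i j * (e i k - e j k)))
      ≈⟨ ∑-comm (λ k i → sum λ j → φ k * (g i j * (e i k - e j k))) ⟩
    ∑[ i < m ] ∑[ k < m ] ∑[ j < m ] (φ k * (g i j * (e i k - e j k)))
      ≈⟨ sum-cong-≋ (λ i → ∑-comm (λ k j → φ k * (g i j * (e i k - e j k)))) ⟩
    ∑[ i < m ] ∑[ j < m ] ∑[ k < m ] (φ k * (g i j * (e i k - e j k)))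
      ≈⟨ sum-cong-≋ (λ i → sum-cong-≋ λ j → inner i j) ⟩
    drop g φ ∎
    where
    inner : ∀ i j → ∑[ k < m ] (φ k * (g i j * (e i k - e j k))) ≈ g i j * (φ i - φ j)
    inner i j = begin
      ∑[ k < m ] (φ k * (g i j * (e i k - e j k)))
        ≈⟨ sum-cong-≋ (λ k → solve 4 (λ p g a b → p :* (g :* (a :- b)) := g :* (p :* a) :+ (:- g) :* (p :* b))
             refl (φ k) (g i j) (e i k) (e j k)) ⟩
      ∑[ k < m ] (g i j * (φ k * e i k) + (- g i j) * (φ k * e j k))
        ≈⟨ ∑-linear (g i j) (- g i j) (λ k → φ k * e i k) (λ k → φ k * e j k) ⟩
      g i j * sum (λ k → φ k * e i k) + (- g i j) * sum (λ k → φ k * e j k)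
        ≈⟨ +-cong (*-congˡ (∑-e i φ)) (*-congˡ (∑-e j φ)) ⟩
      g i j * φ i + (- g i j) * φ j
        ≈⟨ solve 3 (λ g a b → g :* a :+ (:- g) :* b := g :* (a :- b)) refl (g i j) (φ i) (φ j) ⟩
      g i j * (φ i - φ j) ∎

  sum-e : (i : Fin m) → sum (e i) ≈ 1#
  sum-e {m} i = trans (sum-cong-≋ {m} λ k → sym (*-identityˡ (e i k))) (∑-e i (λ _ → 1#))

  -- A full matrix vanishing off the arcs, so that flows combine entrywise. No sign is imposed,
  -- because circulations and flows along undirected paths need both signs.
  record Flow (D : Digraph m) (x : Point m) : Set where
    field
      amount    : Matrix m
      supported : ∀ i j → ¬ Arc D i j → amount i j ≈ 0#
      boundary  : ∀ k → x k ≈ ∂ amount k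

  open Flow public

  Nonnegative : {D : Digraph m} {x : Point m} → Flow D x → Set
  Nonnegative F = ∀ i j → 0# ≤ amount F i j

  module _ {D : Digraph m} {x : Point m} where

    rootCone⇒flow : rootCone D x → Σ (Flow D x) Nonnegative
    rootCone⇒flow (f , f≥0 , x≈) = record
      { amount    = g
      ; supported = g-supported
      ; boundary  = λ k → trans (x≈ k) (sum-cong-≋ λ i → sum-cong-≋ λ j → g-term k i j)
      } , g≥0
      where
      g : Matrix m
      -- `rootCone` does not constrain `f` off the arcs; the default 0 there makes `g` supported and
      -- nonnegative everywhere.
      g i j = if does (arc? D i j) then f i j else 0#
      g-supported : ∀ i j → ¬ Arc D i j → g i j ≈ 0#
      g-supported i j ¬arc with arc? D i j
      ... | yes arc = contradiction arc ¬arc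
      ... | no  _   = refl
      g-term : ∀ k i j → (if does (arc? D i j) then f i j * (e i k - e j k) else 0#) ≈ g i j * (e i k - e j k)
      g-term k i j with arc? D i j
      ... | yes _ = refl
      ... | no  _ = sym (zeroˡ _)
      g≥0 : ∀ i j → 0# ≤ g i j
      g≥0 i j with arc? D i j
      ... | yes arc = f≥0 arc
      ... | no  _   = ≤.refl

    flow⇒rootCone : (F : Flow D x) → (∀ {i j} → Arc D i j → 0# ≤ amount F i j) → rootCone D x
    flow⇒rootCone F F≥0 = amount F , F≥0 , λ k →
      trans (boundary F k) (sum-cong-≋ λ i → sum-cong-≋ λ j → term k i j)
      where
      term : ∀ k i j → amount F i j * (e i k - e j k) ≈
             (if does (arc? D i j) then amount F i j * (e i k - e j k) else 0#)
      term k i j with arc? D i j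
      ... | yes _   = refl
      ... | no ¬arc = trans (*-congʳ (supported F i j ¬arc)) (zeroˡ _)

    weightedSum-flow : (F : Flow D x) (φ : Fin m → Carrier) → ∑[ k < m ] (φ k * x k) ≈ drop (amount F) φ
    weightedSum-flow F φ = trans (sum-cong-≋ λ k → *-congˡ (boundary F k)) (weightedSum-∂ φ (amount F))

    sumOver-flow : (F : Flow D x) (S : Subset m) → sumOver S x ≈ drop (amount F) (χ S)
    sumOver-flow F S = trans (sumOver-χ S x) (weightedSum-flow F (χ S))

    flow⇒V∅ : Flow D x → V∅ x
    flow⇒V∅ F = begin
      sum x                            ≈⟨ sum-cong-≋ (λ k → sym (*-identityˡ (x k))) ⟩
      ∑[ k < m ] (1# * x k)            ≈⟨ weightedSum-flow F (λ _ → 1#) ⟩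
      drop (amount F) (λ _ → 1#)       ≈⟨ ∑-zero {m} _ (λ i → ∑-zero {m} _ λ j →
                                            trans (*-congˡ (-‿inverseʳ 1#)) (zeroʳ (amount F i j))) ⟩
      0#                               ∎

    -- Termwise: the difference of the indicators at the ends of an arc is negative only on arcs
    -- entering S.
    inArcs-empty⇒nonneg : ∀ S → Empty (inArcs D S) → rootCone D x → 0# ≤ sumOver S x
    inArcs-empty⇒nonneg S empty x∈C with rootCone⇒flow x∈C
    ... | F , F≥0 = nonneg-resp (sym (sumOver-flow F S)) (∑-nonneg _ λ i → ∑-nonneg _ λ j → term i j)
      where
      term : ∀ i j → 0# ≤ amount F i j * (χ S i - χ S j)
      term i j with i ∈? S | j ∈? S
      ... | yes _   | yes _   = *-nonneg (F≥0 i j) (≤.reflexive (sym (-‿inverseʳ 1#)))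
      ... | yes _   | no  _   = *-nonneg (F≥0 i j)
        (nonneg-resp (solve 0 (con (1 , 0) := con (1 , 0) :- con (0 , 0)) refl) nonneg-1)
      ... | no  _   | no  _   = *-nonneg (F≥0 i j) (≤.reflexive (sym (-‿inverseʳ 0#)))
      ... | no  i∉S | yes j∈S = ≤.reflexive (sym (trans
        (*-congʳ (supported F i j λ arc → empty (i , j) (arc , j∈S , i∉S))) (zeroˡ _)))

    outArcs-empty⇒nonpos : ∀ S → Empty (outArcs D S) → rootCone D x → 0# ≤ - sumOver S x
    outArcs-empty⇒nonpos S empty x∈C = nonneg-resp (sumOver-∁ S (flow⇒V∅ (proj₁ (rootCone⇒flow x∈C))))
      (inArcs-empty⇒nonneg (∁ S)
        (λ { (i , j) (arc , j∈∁S , i∉∁S) → empty (i , j) (arc , x∉∁p⇒x∈p i∉∁S , x∈∁p⇒x∉p j∈∁S) }) x∈C)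

    -- Only one term of the pairing with `χ S` survives. Since `only` is about undirected edges, the
    -- reversed arc has to be excluded separately.
    sumOver-cut : (F : Flow D x) {S : Subset m} {a b : Fin m} → a ∈ S → b ∉ S →
      (∀ {i j} → Edge D i j → i ∈ S → j ∉ S → i ≡ a × j ≡ b) → ¬ Arc D b a → sumOver S x ≈ amount F a b
    sumOver-cut F {S} {a} {b} a∈S b∉S only ¬ba = begin
      sumOver S x
        ≈⟨ sumOver-flow F S ⟩
      drop (amount F) (χ S)
        ≈⟨ ∑-single _ a (λ i a≢i → ∑-zero _ λ j → vanish i j λ { (i≡a , _) → a≢i (≡.sym i≡a) }) ⟩
      ∑[ j < m ] (amount F a j * (χ S a - χ S j))
        ≈⟨ ∑-single _ b (λ j b≢j → vanish a j λ { (_ , j≡b) → b≢j (≡.sym j≡b) }) ⟩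
      amount F a b * (χ S a - χ S b)
        ≈⟨ *-congˡ (+-cong ([]-yes (a ∈? S) a∈S) (-‿cong ([]-no (b ∈? S) b∉S))) ⟩
      amount F a b * (1# - 0#)
        ≈⟨ solve 1 (λ f → f :* (con (1 , 0) :- con (0 , 0)) := f) refl _ ⟩
      amount F a b ∎
      where
      vanish : ∀ i j → ¬ (i ≡ a × j ≡ b) → amount F i j * (χ S i - χ S j) ≈ 0#
      vanish i j ≢ab with i ∈? S | j ∈? S
      ... | yes _   | yes _   = trans (*-congˡ (-‿inverseʳ 1#)) (zeroʳ _)
      ... | no  _   | no  _   = trans (*-congˡ (-‿inverseʳ 0#)) (zeroʳ _)
      ... | yes i∈S | no  j∉S = trans (*-congʳ (supported F i j λ arc → ≢ab (only (fwd arc) i∈S j∉S))) (zeroˡ _)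
      ... | no  i∉S | yes j∈S = trans (*-congʳ (supported F i j λ arc →
        let (j≡a , i≡b) = only (bwd arc) j∈S i∉S in ¬ba (≡.subst₂ (Arc D) i≡b j≡a arc))) (zeroˡ _)

    flow-resp : {y : Point m} → (∀ k → x k ≈ y k) → Flow D x → Flow D y
    flow-resp x≈y F = record
      { amount = amount F ; supported = supported F ; boundary = λ k → trans (sym (x≈y k)) (boundary F k) }

    flow-linear : {y : Point m} (s t : Carrier) → Flow D x → Flow D y → Flow D (λ k → s * x k + t * y k)
    flow-linear s t F G = record
      { amount    = λ i j → s * amount F i j + t * amount G i j
      ; supported = λ i j ¬arc → trans
          (+-cong (*-congˡ (supported F i j ¬arc)) (*-congˡ (supported G i j ¬arc)))
          (solve 2 (λ s t → s :* con (0 , 0) :+ t :* con (0 , 0) := con (0 , 0)) refl s t)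
      ; boundary  = λ k → trans (+-cong (*-congˡ (boundary F k)) (*-congˡ (boundary G k)))
          (sym (drop-linear s t (amount F) (amount G) (λ i → e i k)))
      }

  module _ {D : Digraph m} where

    flow-zero : Flow D (λ _ → 0#)
    flow-zero = record
      { amount    = λ _ _ → 0#
      ; supported = λ _ _ _ → refl
      ; boundary  = λ k → sym (∑-zero {m} _ λ i → ∑-zero {m} _ λ j → zeroˡ (e i k - e j k))
      }

    flow-∑ : (c : Fin n → Carrier) (y : Fin n → Point m) → (∀ i → Flow D (y i)) →
             Flow D (λ k → ∑[ i < n ] (c i * y i k))
    flow-∑ {zero}  c y F = flow-zero
    flow-∑ {suc n} c y F = flow-resp (λ k → +-congˡ (*-identityˡ _))
      (flow-linear (c zero) 1# (F zero) (flow-∑ (λ i → c (suc i)) (λ i → y (suc i)) (λ i → F (suc i))))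

    -- Each source i sends amounts proportional to v. With basis vectors this is the unit flow on an
    -- arc; the separating flow combines two others.
    flow-product : (u v : Fin m → Carrier) → (∀ i j → ¬ Arc D i j → u i * v j ≈ 0#) →
                   Flow D (λ k → sum v * u k + (- v k) * sum u)
    flow-product u v uv-supported = record
      { amount    = λ i j → u i * v j
      ; supported = uv-supported
      ; boundary  = λ k → sym (trans (drop-product u v (λ i → e i k))
          (+-cong (*-congˡ (∑-e-transposed k u)) (*-congʳ (-‿cong (∑-e-transposed k v)))))
      }

    flow-arc : ∀ {a b} → Arc D a b → Flow D (λ k → e a k - e b k)
    flow-arc {a} {b} arc = flow-resp
      (λ k → trans (+-cong (*-congʳ (sum-e b)) (*-congˡ (sum-e a)))
        (solve 2 (λ a b → con (1 , 0) :* a :+ (:- b) :* con (1 , 0) := a :- b) refl (e a k) (e b k)))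
      (flow-product (e a) (e b) λ i j ¬arc → vanish i j ¬arc)
      where
      vanish : ∀ i j → ¬ Arc D i j → e a i * e b j ≈ 0#
      vanish i j ¬arc with a ≟ i | b ≟ j
      ... | yes ≡.refl | yes ≡.refl = contradiction arc ¬arc
      ... | yes _      | no  _      = zeroʳ _
      ... | no  _      | yes _      = zeroˡ _
      ... | no  _      | no  _      = zeroˡ _

    flow-path : ∀ {a b} → EqClosure (Arc D) a b → Flow D (λ k → e a k - e b k)
    flow-path ε = flow-resp (λ k → sym (-‿inverseʳ _)) flow-zero
    flow-path {a} {b} (_◅_ {j = c} (fwd arc) path) = flow-resp
      (λ k → solve 3 (λ a b c → con (1 , 0) :* (a :- c) :+ con (1 , 0) :* (c :- b) := a :- b)
        refl (e a k) (e b k) (e c k))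
      (flow-linear 1# 1# (flow-arc arc) (flow-path path))
    flow-path {a} {b} (_◅_ {j = c} (bwd arc) path) = flow-resp
      (λ k → solve 3 (λ a b c → (:- con (1 , 0)) :* (c :- a) :+ con (1 , 0) :* (c :- b) := a :- b)
        refl (e a k) (e b k) (e c k))
      (flow-linear (- 1#) 1# (flow-arc arc) (flow-path path))

    -- Each amount `x i` is routed from i to the root r; what accumulates at r is the total, which
    -- is zero.
    connected⇒flow : Connected D → Fin m → {x : Point m} → V∅ x → Flow D x
    connected⇒flow conn r {x} ∑x≈0 = flow-resp expand
      (flow-∑ x (λ i k → e i k - e r k) (λ i → flow-path (conn i r)))
      where
      expand : ∀ k → ∑[ i < m ] (x i * (e i k - e r k)) ≈ x k
      expand k = begin
        ∑[ i < m ] (x i * (e i k - e r k))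
          ≈⟨ sum-cong-≋ (λ i → solve 3 (λ x a b → x :* (a :- b) := con (1 , 0) :* (x :* a) :+ (:- b) :* x)
               refl (x i) (e i k) (e r k)) ⟩
        ∑[ i < m ] (1# * (x i * e i k) + (- e r k) * x i)
          ≈⟨ ∑-linear 1# (- e r k) (λ i → x i * e i k) x ⟩
        1# * sum (λ i → x i * e i k) + (- e r k) * sum x
          ≈⟨ +-cong (*-congˡ (∑-e-transposed k x)) (*-congˡ ∑x≈0) ⟩
        1# * x k + (- e r k) * 0#
          ≈⟨ solve 2 (λ x b → con (1 , 0) :* x :+ (:- b) :* con (0 , 0) := x) refl (x k) (e r k) ⟩
        x k ∎

  -- Cuts of trees; excluded middle turns reachability into a `Subset`

  subset : (Fin m → Set) → Subset m
  subset P = tabulate λ i → does (decide (P i))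

  ∈-subset⁺ : (P : Fin m → Set) → P i → i ∈ subset P
  ∈-subset⁺ {i = i} P p = lookup⇒[]= i _ (≡.trans (lookup∘tabulate _ i) (holds (decide (P i)) p))
    where
    holds : {Q : Set} (d : Dec Q) → Q → does d ≡ true
    holds (yes _) q = ≡.refl
    holds (no ¬q) q = contradiction q ¬q

  ∈-subset⁻ : (P : Fin m → Set) → i ∈ subset P → P i
  ∈-subset⁻ {i = i} P i∈ = holds (decide (P i)) (≡.trans (≡.sym (lookup∘tabulate _ i)) ([]=⇒lookup i∈))
    where
    holds : {Q : Set} (d : Dec Q) → does d ≡ true → Q
    holds (yes q) _ = q

  digraph : Rel (Fin m) 0ℓ → Digraph m
  digraph R = tabulate λ i → subset (R i)

  Arc-digraph⁺ : (R : Rel (Fin m) 0ℓ) → R i j → Arc (digraph R) i j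
  Arc-digraph⁺ {i = i} {j = j} R r =
    ≡.subst (j ∈_) (≡.sym (lookup∘tabulate _ i)) (∈-subset⁺ (R i) r)

  Arc-digraph⁻ : (R : Rel (Fin m) 0ℓ) → Arc (digraph R) i j → R i j
  Arc-digraph⁻ {i = i} {j = j} R arc = ∈-subset⁻ (R i) (≡.subst (j ∈_) (lookup∘tabulate _ i) arc)

  without : Digraph m → Fin m → Fin m → Rel (Fin m) 0ℓ
  without D a b i j = Arc D i j × ¬ (i ≡ a × j ≡ b)

  remove : Digraph m → Fin m → Fin m → Digraph m
  remove D a b = digraph (without D a b)

  remove-⊆ : (D : Digraph m) → Arc (remove D a b) i j → Arc D i j
  remove-⊆ {a = a} {b} D = proj₁ ∘ Arc-digraph⁻ (without D a b)

  remove-∌ : (D : Digraph m) → ¬ Arc (remove D a b) a b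
  remove-∌ {a = a} {b} D arc = proj₂ (Arc-digraph⁻ (without D a b) arc) (≡.refl , ≡.refl)

  edge-remove : (D : Digraph m) → Edge D i j → ¬ (i ≡ a × j ≡ b) → ¬ (j ≡ a × i ≡ b) → Edge (remove D a b) i j
  edge-remove D (fwd arc) ≢₁ ≢₂ = fwd (Arc-digraph⁺ (without D _ _) (arc , ≢₁))
  edge-remove D (bwd arc) ≢₁ ≢₂ = bwd (Arc-digraph⁺ (without D _ _) (arc , ≢₂))

  module _ {T : Digraph m} (tree : IsAlternatingTree T) where
    open IsAlternatingTree tree

    no-two-step : ∀ {h} → Arc T h i → ¬ Arc T i j
    no-two-step {i = i} hi ij with alternating i
    ... | inj₁ source = source _ hi
    ... | inj₂ sink   = sink _ ij

    record Cut (a b : Fin m) : Set where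
      field
        side      : Subset m
        tail∈     : a ∈ side
        head∉     : b ∉ side
        only      : Edge T i j → i ∈ side → j ∉ side → i ≡ a × j ≡ b

    -- The side is the component of a after removing the arc. An edge leaving it other than the arc
    -- would survive the removal and extend the component; a path inside it to b would close up to a
    -- cycle.
    cut : Arc T a b → Cut a b
    cut {a} {b} ab = record
      { side  = subset (EqClosure (Arc T′) a)
      ; tail∈ = ∈-subset⁺ (EqClosure (Arc T′) a) ε
      ; head∉ = λ b∈ → separated (simplify (∈-subset⁻ (EqClosure (Arc T′) a) b∈))
      ; only  = only
      }
      where
      T′ : Digraph m
      T′ = remove T a b

      only : Edge T i j → i ∈ subset (EqClosure (Arc T′) a) → j ∉ subset (EqClosure (Arc T′) a) →
             i ≡ a × j ≡ b
      only {i} {j} edge i∈ j∉ = by-contradiction λ ≢ab →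
        j∉ (∈-subset⁺ (EqClosure (Arc T′) a) (∈-subset⁻ (EqClosure (Arc T′) a) i∈ ◅◅
          (edge-remove T edge ≢ab (λ { (≡.refl , _) → j∉ (∈-subset⁺ (EqClosure (Arc T′) a) ε) }) ◅ ε)))

      edge-⊆ : Edge T′ i j → Edge T i j
      edge-⊆ (fwd arc) = fwd (remove-⊆ T arc)
      edge-⊆ (bwd arc) = bwd (remove-⊆ T arc)

      separated : ¬ SimplePath (Edge T′) a b
      -- A `Cycle` has at least three vertices, so paths with fewer than two steps are excluded by
      -- alternation and by the removal itself.
      separated (simplePath {zero} v _ _ ≡.refl ≡.refl) = no-two-step ab ab
      separated (simplePath {suc zero} v _ adj ≡.refl ≡.refl) with adj zero
      ... | fwd arc = remove-∌ T arc
      ... | bwd arc = no-two-step ab (remove-⊆ T arc)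
      separated (simplePath {suc (suc n)} v inj adj ≡.refl ≡.refl) =
        acyclic (n , v , inj , edge-⊆ ∘ adj , bwd ab)

  -- Cancelling cycles in nonnegative flows

  cycle⇒redundant : Cycle D → ∃[ a ] ∃[ b ] Arc D a b × EqClosure (Arc (remove D a b)) a b
  -- The closing edge is the redundant one: the other edges join its ends, and injectivity keeps
  -- them different from it.
  cycle⇒redundant {D = D} (k , v , inj , adj , closing) = from closing
    where
    not-closing₁ : ∀ p → ¬ (v (inject₁ p) ≡ v (fromℕ _) × v (suc p) ≡ v zero)
    not-closing₁ p (eq , _) = fromℕ≢inject₁ (≡.sym (inj eq))

    not-closing₂ : ∀ p → ¬ (v (inject₁ p) ≡ v zero × v (suc p) ≡ v (fromℕ _))
    -- With at least three vertices, the second vertex is not the last.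
    not-closing₂ zero (_ , eq) with inj eq
    ... | ()
    not-closing₂ (suc p) (eq , _) with inj eq
    ... | ()

    from : Edge D (v (fromℕ _)) (v zero) → ∃[ a ] ∃[ b ] Arc D a b × EqClosure (Arc (remove D a b)) a b
    from (fwd arc) = _ , _ , arc , Eq.symmetric _ (chain v λ p →
      edge-remove D (adj p) (not-closing₁ p) (λ (eq₁ , eq₂) → not-closing₂ p (eq₂ , eq₁)))
    from (bwd arc) = _ , _ , arc , chain v λ p →
      edge-remove D (adj p) (not-closing₂ p) (λ (eq₁ , eq₂) → not-closing₁ p (eq₂ , eq₁))

  arcCount-remove : Arc D a b → arcCount (remove D a b) ℕ.< arcCount D
  arcCount-remove {D = D} {a} {b} ab = strict
    (λ i → p⊆q⇒∣p∣≤∣q∣ {p = lookup (remove D a b) i} {q = lookup D i} (remove-⊆ D)) a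
    (p⊂q⇒∣p∣<∣q∣ {p = lookup (remove D a b) a} {q = lookup D a} (remove-⊆ D , b , ab , remove-∌ D))
    where
    mono : ∀ {n} {f g : Fin n → ℕ} → (∀ i → f i ℕ.≤ g i) → ∑ℕ f ℕ.≤ ∑ℕ g
    mono {zero}  f≤g = ℕ.≤-refl
    mono {suc n} f≤g = ℕ.+-mono-≤ (f≤g zero) (mono (f≤g ∘ suc))
    strict : ∀ {n} {f g : Fin n → ℕ} → (∀ i → f i ℕ.≤ g i) → ∀ i → f i ℕ.< g i → ∑ℕ f ℕ.< ∑ℕ g
    strict f≤g zero    f<g = ℕ.+-mono-<-≤ f<g (mono (f≤g ∘ suc))
    strict f≤g (suc i) f<g = ℕ.+-mono-≤-< (f≤g zero) (strict (f≤g ∘ suc) i f<g)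

  argmin : (P : Fin n → Set) (r : Fin n → Carrier) → ∃ P → ∃[ i ] P i × (∀ j → P j → r i ≤ r j)
  argmin {suc n} P r ∃P with decide (∃ (P ∘ suc))
  ... | no none = zero , P₀ ∃P , λ { zero _ → ≤.refl ; (suc j) Pj → contradiction (j , Pj) none }
    where
    P₀ : ∃ P → P zero
    P₀ (zero  , p) = p
    P₀ (suc i , p) = contradiction (i , p) none
  ... | yes some with argmin (P ∘ suc) (r ∘ suc) some | decide (P zero)
  ...   | i , Pi , least | no ¬P₀ = suc i , Pi , λ { zero P₀ → contradiction P₀ ¬P₀ ; (suc j) → least j }
  ...   | i , Pi , least | yes P₀ with ≤.total (r zero) (r (suc i))
  ...     | inj₁ r₀≤ = zero , P₀ , λ { zero _ → ≤.refl ; (suc j) Pj → ≤.trans r₀≤ (least j Pj) }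
  ...     | inj₂ ≤r₀ = suc i , Pi , λ { zero _ → ≤r₀ ; (suc j) → least j }

  argmin₂ : (P : Fin m → Fin n → Set) (r : Fin m → Fin n → Carrier) → ∃[ i ] ∃[ j ] P i j →
            ∃[ i ] ∃[ j ] P i j × (∀ k l → P k l → r i j ≤ r k l)
  argmin₂ {m} {n} P r (i , j , Pij) with argmin (uncurry P ∘ remQuot n) (uncurry r ∘ remQuot n)
    (combine i j , ≡.subst (uncurry P) (≡.sym (remQuot-combine i j)) Pij)
  ... | c , Pc , least = _ , _ , Pc , λ k l Pkl → ≡.subst (λ p → _ ≤ uncurry r p) (remQuot-combine k l)
    (least (combine k l) (≡.subst (uncurry P) (≡.sym (remQuot-combine k l)) Pkl))

  -- Made total by the default 0, so that a ratio exists for every pair of vertices; only ratios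
  -- with positive denominator are compared.
  recip : Carrier → Carrier
  recip x with decide (0# ≺ x)
  ... | yes x>0 = proj₁ (pos-inverse x>0)
  ... | no  _   = 0#

  recip-nonneg : ∀ x → 0# ≤ recip x
  recip-nonneg x with decide (0# ≺ x)
  ... | yes x>0 = proj₁ (proj₁ (proj₂ (pos-inverse x>0)))
  ... | no  _   = ≤.refl

  *-recip : ∀ {x} → 0# ≺ x → x * recip x ≈ 1#
  *-recip {x} x>0 with decide (0# ≺ x)
  ... | yes x>0′ = proj₂ (proj₂ (pos-inverse x>0′))
  ... | no  x≯0  = contradiction x>0 x≯0

  flow-difference : Flow D x → Flow D x → Flow D (λ _ → 0#)
  flow-difference {x = x} F G = record
    { amount    = λ i j → amount F i j - amount G i j
    ; supported = λ i j ¬arc → trans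
        (+-cong (supported F i j ¬arc) (-‿cong (supported G i j ¬arc))) (-‿inverseʳ 0#)
    ; boundary  = λ k → trans (sym (-‿inverseʳ (x k))) (trans
        (+-cong (boundary F k) (-‿cong (boundary G k)))
        (trans (solve 2 (λ f g → f :- g := con (1 , 0) :* f :+ (:- con (1 , 0)) :* g) refl _ _)
          (trans (sym (drop-linear 1# (- 1#) (amount F) (amount G) (λ i → e i k)))
            (drop-cong (λ i → e i k) λ i j →
              solve 2 (λ f g → con (1 , 0) :* f :+ (:- con (1 , 0)) :* g := f :- g) refl _ _))))
    }

  -- The ratio test of the simplex method: the circulation H is subtracted from F until an arc becomes empty.
  cancel : (F : Flow D x) → Nonnegative F → (H : Flow D (λ _ → 0#)) → 0# ≺ amount H a b →
           ∃[ c ] ∃[ d ] Arc D c d × Σ (Flow (remove D c d) x) Nonnegative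
  cancel {m} {D} {x} {a} {b} F F≥0 H Hab>0 = from
    (argmin₂ (λ i j → 0# ≺ amount H i j) ratio (a , b , Hab>0))
    where
    ratio : Matrix m
    ratio i j = amount F i j * recip (amount H i j)

    from : (∃[ c ] ∃[ d ] 0# ≺ amount H c d × (∀ i j → 0# ≺ amount H i j → ratio c d ≤ ratio i j)) →
           ∃[ c ] ∃[ d ] Arc D c d × Σ (Flow (remove D c d) x) Nonnegative
    from (c , d , Hcd>0 , least) =
      c , d , by-contradiction (λ ¬cd → pos⇒≉0 Hcd>0 (supported H c d ¬cd)) ,
      record { amount = amount F′ ; supported = supported′ ; boundary = boundary F′ } , F′≥0
      where
      t : Carrier
      t = ratio c d

      F′ : Flow D x
      F′ = flow-resp (λ k → solve 2 (λ x t → con (1 , 0) :* x :+ (:- t) :* con (0 , 0) := x) refl (x k) t)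
        (flow-linear 1# (- t) F H)

      factor : ∀ {i j} → 0# ≺ amount H i j → amount F′ i j ≈ (ratio i j - t) * amount H i j
      factor {i} {j} H>0 = begin
        1# * f + (- t) * h              ≈⟨ +-congʳ (*-congʳ (*-recip H>0)) ⟨
        (h * recip h) * f + (- t) * h   ≈⟨ solve 4 (λ f h r t →
          (h :* r) :* f :+ (:- t) :* h := (f :* r :- t) :* h) refl f h (recip h) t ⟩
        (f * recip h - t) * h           ∎
        where
        f h : Carrier
        f = amount F i j
        h = amount H i j

      F′≥0 : Nonnegative F′
      F′≥0 i j with decide (0# ≺ amount H i j)
      ... | yes H>0 = nonneg-resp (sym (factor H>0))
        (*-nonneg (≤⇒nonneg (least i j H>0)) (proj₁ H>0))
      -- Where H is not positive, subtracting `t * H` cannot decrease the amount.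
      ... | no  H≯0 = nonneg-resp
        (solve 3 (λ f h t → f :+ t :* (:- h) := con (1 , 0) :* f :+ (:- t) :* h) refl (amount F i j) (amount H i j) t)
        (nonneg-+ (F≥0 i j) (*-nonneg (*-nonneg (F≥0 c d) (recip-nonneg _)) (¬pos⇒nonneg-neg H≯0)))

      supported′ : ∀ i j → ¬ Arc (remove D c d) i j → amount F′ i j ≈ 0#
      supported′ i j ¬arc with decide (i ≡ c × j ≡ d)
      -- The minimising arc has ratio exactly t, so it is emptied.
      ... | yes (≡.refl , ≡.refl) = trans (factor Hcd>0) (trans (*-congʳ (-‿inverseʳ t)) (zeroˡ _))
      ... | no  ≢cd = supported F′ i j λ arc → ¬arc (Arc-digraph⁺ (without D c d) (arc , ≢cd))

  -- The circulation is the unit flow on a redundant arc minus a flow around the rest of the cycle.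
  -- The latter avoids the arc, so the circulation equals 1 there, which is the positive entry that
  -- `cancel` requires.
  shrink : Cycle D → (F : Flow D x) → Nonnegative F →
           ∃[ c ] ∃[ d ] Arc D c d × Σ (Flow (remove D c d) x) Nonnegative
  shrink {m} {D} cyc F F≥0 = from (cycle⇒redundant {D = D} cyc)
    where
    from : (∃[ a ] ∃[ b ] Arc D a b × EqClosure (Arc (remove D a b)) a b) →
           ∃[ c ] ∃[ d ] Arc D c d × Σ (Flow (remove D c d) _) Nonnegative
    from (a , b , ab , path) = cancel F F≥0 (flow-difference E G′) (pos-resp (sym Hab≈1) pos-1)
      where
      E : Flow D (λ k → e a k - e b k)
      E = flow-arc ab
      G : Flow (remove D a b) (λ k → e a k - e b k)
      G = flow-path path
      G′ : Flow D (λ k → e a k - e b k)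
      G′ = record
        { amount    = amount G
        ; supported = λ i j ¬arc → supported G i j λ arc → ¬arc (remove-⊆ D arc)
        ; boundary  = boundary G
        }
      Hab≈1 : amount E a b - amount G a b ≈ 1#
      Hab≈1 = trans
        (+-cong (*-cong ([]-yes (a ≟ a) ≡.refl) ([]-yes (b ≟ b) ≡.refl))
                (-‿cong (supported G a b (remove-∌ D))))
        (solve 0 (con (1 , 0) :* con (1 , 0) :- con (0 , 0) := con (1 , 0)) refl)

  AcyclicSubflow : Digraph m → Point m → Set
  AcyclicSubflow D x =
    ∃[ D′ ] (∀ {i j} → Arc D′ i j → Arc D i j) × ¬ Cycle D′ × Σ (Flow D′ x) Nonnegative

  acyclic-subflow : (F : Flow D x) → Nonnegative F → AcyclicSubflow D x
  acyclic-subflow {m} {D} {x} = go D (<-wellFounded (arcCount D))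
    where
    go : ∀ D → Acc ℕ._<_ (arcCount D) → (F : Flow D x) → Nonnegative F → AcyclicSubflow D x
    go D (acc rec) F F≥0 = case (decide (Cycle D))
      where
      smaller : (∃[ c ] ∃[ d ] Arc D c d × Σ (Flow (remove D c d) x) Nonnegative) → AcyclicSubflow D x
      smaller (c , d , cd , F′ , F′≥0) = widen (go (remove D c d) (rec (arcCount-remove {D = D} cd)) F′ F′≥0)
        where
        widen : AcyclicSubflow (remove D c d) x → AcyclicSubflow D x
        widen (D′ , D′⊆ , rest) = D′ , (λ arc → remove-⊆ D (D′⊆ arc)) , rest
      case : Dec (Cycle D) → AcyclicSubflow D x
      case (no acyclic) = D , (λ arc → arc) , acyclic , F , F≥0
      case (yes cyc)    = smaller (shrink {D = D} cyc F F≥0)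

  -- Separating flows and separating trees

  generic⇒sumOver≉0 : resonanceComplement x → a ∈ S → b ∉ S → ¬ sumOver S x ≈ 0#
  generic⇒sumOver≉0 {S = S} (x∈V , avoids) a∈S b∉S sum≈0 =
    avoids (S , (_ , a∈S) , (⊆⊤ , _ , ∈⊤ , b∉S) , x∈V , sum≈0)

  module SeparatingFlow (S : Subset m) {x : Point m} (x∈V : V∅ x) (sumS>0 : 0# ≺ sumOver S x) where

    Allowed : Rel (Fin m) 0ℓ
    Allowed i j = 0# ≺ x i × 0# ≺ - x j × ¬ (i ∉ S × j ∈ S)

    x⁺ x⁻ : Point m
    x⁺ i = [ decide (0# ≺ x i) ] * x i
    x⁻ i = [ decide (0# ≺ - x i) ] * - x i

    x⁺-nonneg : ∀ i → 0# ≤ x⁺ i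
    x⁺-nonneg i with decide (0# ≺ x i)
    ... | yes p = *-nonneg nonneg-1 (proj₁ p)
    ... | no  _ = ≤.reflexive (sym (zeroˡ _))

    x⁻-nonneg : ∀ i → 0# ≤ x⁻ i
    x⁻-nonneg i with decide (0# ≺ - x i)
    ... | yes p = *-nonneg nonneg-1 (proj₁ p)
    ... | no  _ = ≤.reflexive (sym (zeroˡ _))

    x-split : ∀ i → x i ≈ x⁺ i - x⁻ i
    x-split i with decide (0# ≺ x i) | decide (0# ≺ - x i)
    ... | yes p | yes q = contradiction (proj₁ q) (pos-nonneg⁻¹ p)
    ... | yes _ | no  _ = solve 1 (λ x → x := con (1 , 0) :* x :- con (0 , 0) :* :- x) refl (x i)
    ... | no  _ | yes _ = solve 1 (λ x → x := con (0 , 0) :* x :- con (1 , 0) :* :- x) refl (x i)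
    ... | no ¬p | no ¬q = trans
      (≤-nonneg⁻¹ (nonneg-resp (neg-involutive _) (¬pos⇒nonneg-neg ¬q)) (¬pos⇒nonneg-neg ¬p))
      (solve 1 (λ x → con (0 , 0) := con (0 , 0) :* x :- con (0 , 0) :* :- x) refl (x i))

    -- Supplies `u` inside and `w` outside S, demands `v` inside and `v′` outside; P, W, N, Q are
    -- their totals in this order.
    u w v v′ u′ : Point m
    u  i = χ S i * x⁺ i
    w  i = χ (∁ S) i * x⁺ i
    v  i = χ S i * x⁻ i
    v′ i = χ (∁ S) i * x⁻ i

    P W N Q : Carrier
    P = sum u
    W = sum w
    N = sum v
    Q = sum v′

    -- The supply left after the demand in S has been served, multiplied by P to clear the
    -- denominator of the rate N / P.
    u′ i = P * w i + (P - N) * u i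

    u-nonneg : ∀ i → 0# ≤ u i
    u-nonneg i = *-nonneg ([]-nonneg (i ∈? S)) (x⁺-nonneg i)

    w-nonneg : ∀ i → 0# ≤ w i
    w-nonneg i = *-nonneg ([]-nonneg (i ∈? ∁ S)) (x⁺-nonneg i)

    v-nonneg : ∀ i → 0# ≤ v i
    v-nonneg i = *-nonneg ([]-nonneg (i ∈? S)) (x⁻-nonneg i)

    v′-nonneg : ∀ i → 0# ≤ v′ i
    v′-nonneg i = *-nonneg ([]-nonneg (i ∈? ∁ S)) (x⁻-nonneg i)

    P-N>0 : 0# ≺ P - N
    P-N>0 = pos-resp (begin
      sumOver S x                   ≈⟨ sumOver-χ S x ⟩
      ∑[ i < m ] (χ S i * x i)      ≈⟨ sum-cong-≋ (λ i → trans (*-congˡ (x-split i))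
                                         (solve 3 (λ c p q → c :* (p :- q) := c :* p :- c :* q) refl (χ S i) (x⁺ i) (x⁻ i))) ⟩
      ∑[ i < m ] (u i - v i)        ≈⟨ ∑-distrib-- u v ⟩
      P - N                         ∎) sumS>0

    P>0 : 0# ≺ P
    P>0 = pos-resp (solve 2 (λ p q → (p :- q) :+ q := p) refl P N) (pos-+ P-N>0 (∑-nonneg v v-nonneg))

    x-decomposition : ∀ i → x i ≈ (u i - v i) + (w i - v′ i)
    x-decomposition i = begin
      x i                                        ≈⟨ x-split i ⟩
      x⁺ i - x⁻ i                                ≈⟨ *-identityˡ _ ⟨
      1# * (x⁺ i - x⁻ i)                         ≈⟨ *-congʳ (χ-∁ S i) ⟨
      (χ S i + χ (∁ S) i) * (x⁺ i - x⁻ i)        ≈⟨ solve 4 (λ c d p q →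
        (c :+ d) :* (p :- q) := (c :* p :- c :* q) :+ (d :* p :- d :* q)) refl (χ S i) (χ (∁ S) i) (x⁺ i) (x⁻ i) ⟩
      (u i - v i) + (w i - v′ i)                 ∎

    Q≈ : Q ≈ (P - N) + W
    Q≈ = begin
      Q                                   ≈⟨ +-identityˡ Q ⟨
      0# + Q                              ≈⟨ +-congʳ total ⟨
      ((P - N) + (W - Q)) + Q             ≈⟨ solve 3 (λ p w q → (p :+ (w :- q)) :+ q := p :+ w) refl (P - N) W Q ⟩
      (P - N) + W                         ∎
      where
      total : (P - N) + (W - Q) ≈ 0#
      total = begin
        (P - N) + (W - Q)                                     ≈⟨ +-cong (∑-distrib-- u v) (∑-distrib-- w v′) ⟨
        ∑[ i < m ] (u i - v i) + ∑[ i < m ] (w i - v′ i)      ≈⟨ ∑-distrib-+ (λ i → u i - v i) (λ i → w i - v′ i) ⟨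
        ∑[ i < m ] ((u i - v i) + (w i - v′ i))               ≈⟨ sum-cong-≋ (λ i → sym (x-decomposition i)) ⟩
        sum x                                                 ≈⟨ x∈V ⟩
        0#                                                    ∎

    Q>0 : 0# ≺ Q
    Q>0 = pos-resp (sym Q≈) (pos-+ P-N>0 (∑-nonneg w w-nonneg))

    sum-u′ : sum u′ ≈ P * Q
    sum-u′ = begin
      sum u′                    ≈⟨ ∑-linear P (P - N) w u ⟩
      P * W + (P - N) * P       ≈⟨ solve 3 (λ p d w → p :* w :+ d :* p := p :* (d :+ w)) refl P (P - N) W ⟩
      P * ((P - N) + W)         ≈⟨ *-congˡ Q≈ ⟨
      P * Q                     ∎

    u′-nonneg : ∀ i → 0# ≤ u′ i
    u′-nonneg i = nonneg-+ (*-nonneg (proj₁ P>0) (w-nonneg i)) (*-nonneg (proj₁ P-N>0) (u-nonneg i))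

    x⁺-zero : ∀ i → ¬ 0# ≺ x i → x⁺ i ≈ 0#
    x⁺-zero i ¬p = trans (*-congʳ ([]-no (decide (0# ≺ x i)) ¬p)) (zeroˡ _)

    x⁻-zero : ∀ i → ¬ 0# ≺ - x i → x⁻ i ≈ 0#
    x⁻-zero i ¬p = trans (*-congʳ ([]-no (decide (0# ≺ - x i)) ¬p)) (zeroˡ _)

    u-zero : ∀ i → x⁺ i ≈ 0# ⊎ i ∉ S → u i ≈ 0#
    u-zero i (inj₁ p)   = trans (*-congˡ p) (zeroʳ _)
    u-zero i (inj₂ i∉S) = trans (*-congʳ ([]-no (i ∈? S) i∉S)) (zeroˡ _)

    v′-zero : ∀ i → x⁻ i ≈ 0# ⊎ i ∈ S → v′ i ≈ 0#
    v′-zero i (inj₁ p)   = trans (*-congˡ p) (zeroʳ _)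
    v′-zero i (inj₂ i∈S) = trans (*-congʳ ([]-no (i ∈? ∁ S) (x∈p⇒x∉∁p i∈S))) (zeroˡ _)

    u′-zero : ∀ i → x⁺ i ≈ 0# → u′ i ≈ 0#
    u′-zero i p = trans (+-cong (*-congˡ (trans (*-congˡ p) (zeroʳ _))) (*-congˡ (u-zero i (inj₁ p))))
      (solve 2 (λ s t → s :* con (0 , 0) :+ t :* con (0 , 0) := con (0 , 0)) refl P (P - N))

    network : Digraph m
    network = digraph Allowed

    private
      by-factor : ∀ {p q} → p ≈ 0# ⊎ q ≈ 0# → p * q ≈ 0#
      by-factor (inj₁ p≈0) = trans (*-congʳ p≈0) (zeroˡ _)
      by-factor (inj₂ q≈0) = trans (*-congˡ q≈0) (zeroʳ _)

    -- A nonzero product starts at some i in S, so the arc does not enter S; in `u′v′-supported` the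
    -- same follows from j lying outside S.
    uv-supported : ∀ i j → ¬ Arc network i j → u i * v j ≈ 0#
    uv-supported i j ¬arc = by-factor (cases (decide (0# ≺ x i)) (decide (0# ≺ - x j)) (decide (i ∉ S)))
      where
      cases : Dec (0# ≺ x i) → Dec (0# ≺ - x j) → Dec (i ∉ S) → u i ≈ 0# ⊎ v j ≈ 0#
      cases (no ¬p) _       _         = inj₁ (u-zero i (inj₁ (x⁺-zero i ¬p)))
      cases (yes _) (no ¬q) _         = inj₂ (trans (*-congˡ (x⁻-zero j ¬q)) (zeroʳ _))
      cases (yes _) (yes _) (yes i∉S) = inj₁ (u-zero i (inj₂ i∉S))
      cases (yes p) (yes q) (no i∈S)  = contradiction (Arc-digraph⁺ Allowed (p , q , i∈S ∘ proj₁)) ¬arc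

    u′v′-supported : ∀ i j → ¬ Arc network i j → u′ i * v′ j ≈ 0#
    u′v′-supported i j ¬arc = by-factor (cases (decide (0# ≺ x i)) (decide (0# ≺ - x j)) (j ∈? S))
      where
      cases : Dec (0# ≺ x i) → Dec (0# ≺ - x j) → Dec (j ∈ S) → u′ i ≈ 0# ⊎ v′ j ≈ 0#
      cases (no ¬p) _       _         = inj₁ (u′-zero i (x⁺-zero i ¬p))
      cases (yes _) (no ¬q) _         = inj₂ (v′-zero j (inj₁ (x⁻-zero j ¬q)))
      cases (yes _) (yes _) (yes j∈S) = inj₂ (v′-zero j (inj₂ j∈S))
      cases (yes p) (yes q) (no j∉S)  = contradiction (Arc-digraph⁺ Allowed (p , q , j∉S ∘ proj₂)) ¬arc

    -- S supplies all of its own demand v, at the rate N / P from each of its sources;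
    -- what remains of the supply goes, proportionally, to the demand v′ outside S.
    separatingFlow : Σ (Flow network x) Nonnegative
    separatingFlow = from (pos-inverse P>0) (pos-inverse Q>0)
      where
      from : ∃[ p ] 0# ≺ p × P * p ≈ 1# → ∃[ q ] 0# ≺ q × Q * q ≈ 1# → Σ (Flow network x) Nonnegative
      -- The weights are 1/P and 1/(PQ). The scaled boundaries are (N/P) u - v and u′/P - v′, where
      -- u′/P = w + (1 - N/P) u, so their sum is x.
      from (p , p>0 , Pp≈1) (q , q>0 , Qq≈1) = flow-resp balance (flow-linear p (p * q) F F′) , λ i j → nonneg-+
        (*-nonneg (proj₁ p>0) (*-nonneg (u-nonneg i) (v-nonneg j)))
        (*-nonneg (*-nonneg (proj₁ p>0) (proj₁ q>0)) (*-nonneg (u′-nonneg i) (v′-nonneg j)))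
        where
        F : Flow network (λ k → N * u k + (- v k) * P)
        F = flow-product u v uv-supported
        F′ : Flow network (λ k → Q * u′ k + (- v′ k) * sum u′)
        F′ = flow-product u′ v′ u′v′-supported
        balance : ∀ k → p * (N * u k + (- v k) * P) + (p * q) * (Q * u′ k + (- v′ k) * sum u′) ≈ x k
        balance k = begin
          p * (N * u k + (- v k) * P) + (p * q) * (Q * u′ k + (- v′ k) * sum u′)
            ≈⟨ +-congˡ (*-congˡ (+-congˡ (*-congˡ sum-u′))) ⟩
          p * (N * u k + (- v k) * P) + (p * q) * (Q * u′ k + (- v′ k) * (P * Q))
            ≈⟨ +-congˡ (solve 6 (λ p q Q a b P → (p :* q) :* (Q :* a :+ (:- b) :* (P :* Q)) := (Q :* q) :* (p :* (a :- P :* b)))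
                 refl p q Q (u′ k) (v′ k) P) ⟩
          p * (N * u k + (- v k) * P) + (Q * q) * (p * (u′ k - P * v′ k))
            ≈⟨ +-congˡ (trans (*-congʳ Qq≈1) (*-identityˡ _)) ⟩
          p * (N * u k + (- v k) * P) + p * (u′ k - P * v′ k)
            ≈⟨ distribˡ p _ _ ⟨
          p * ((N * u k + (- v k) * P) + (u′ k - P * v′ k))
            ≈⟨ *-congˡ (solve 6 (λ N P u v w v′ → (N :* u :+ (:- v) :* P) :+ ((P :* w :+ (P :- N) :* u) :- P :* v′)
                 := P :* ((u :- v) :+ (w :- v′))) refl N P (u k) (v k) (w k) (v′ k)) ⟩
          p * (P * ((u k - v k) + (w k - v′ k)))
            ≈⟨ solve 3 (λ p P y → p :* (P :* y) := (P :* p) :* y) refl p P _ ⟩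
          (P * p) * ((u k - v k) + (w k - v′ k))
            ≈⟨ *-cong Pp≈1 (sym (x-decomposition k)) ⟩
          1# * x k
            ≈⟨ *-identityˡ _ ⟩
          x k ∎

  SeparatingTree : Subset m → Point m → Set
  SeparatingTree S x = ∃[ T ] IsAlternatingTree T × rootCone T x × Empty (inArcs T S)

  separatingTree : (S : Subset m) → resonanceComplement x → 0# ≺ sumOver S x → SeparatingTree S x
  separatingTree {m} {x} S generic sumS>0 = from (uncurry acyclic-subflow separatingFlow)
    where
    open SeparatingFlow S (proj₁ generic) sumS>0
    from : AcyclicSubflow network x → SeparatingTree S x
    from (T , T⊆ , acyclic , F , F≥0) = T , tree , x∈C , λ { (j , i) (arc , i∈S , j∉S) →
      proj₂ (proj₂ (allowed arc)) (j∉S , i∈S) }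
      where
      allowed : Arc T i j → Allowed i j
      allowed arc = Arc-digraph⁻ Allowed (T⊆ arc)
      x∈C : rootCone T x
      x∈C = flow⇒rootCone F (λ {i} {j} _ → F≥0 i j)
      connected : Connected T
      -- No edge crosses the component C, so the flow forces the sum over C to be both nonnegative
      -- and nonpositive, against genericity.
      connected i j = by-contradiction λ ¬ij →
        let C = subset (EqClosure (Arc T) i)
            closed : ∀ {k l} → Edge T k l → k ∈ C → l ∈ C
            closed edge k∈C = ∈-subset⁺ (EqClosure (Arc T) i) (∈-subset⁻ (EqClosure (Arc T) i) k∈C ◅◅ (edge ◅ ε))
        in generic⇒sumOver≉0 {S = C} generic (∈-subset⁺ (EqClosure (Arc T) i) ε)
             (λ j∈C → ¬ij (∈-subset⁻ (EqClosure (Arc T) i) j∈C))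
             (≤-nonneg⁻¹
               (inArcs-empty⇒nonneg {D = T} C (λ { _ (arc , k∈C , l∉C) → l∉C (closed (bwd arc) k∈C) }) x∈C)
               (outArcs-empty⇒nonpos {D = T} C (λ { _ (arc , k∈C , l∉C) → l∉C (closed (fwd arc) k∈C) }) x∈C))
      tree : IsAlternatingTree T
      tree = record { connected = connected ; acyclic = acyclic ; alternating = alternating }
        where
        alternating : ∀ i → IsSource T i ⊎ IsSink T i
        alternating i with decide (0# ≺ x i)
        ... | yes p = inj₁ λ j ji → pos-nonneg⁻¹ p (proj₁ (proj₁ (proj₂ (allowed ji))))
        ... | no ¬p = inj₂ λ j ij → ¬p (proj₁ (allowed ij))

  -- Root cones as intersections of half-spaces

  module _ {T : Digraph m} (tree : IsAlternatingTree T) where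
    open Cut

    inArcs-cut-empty : (ab : Arc T a b) → Empty (inArcs T (side (cut tree ab)))
    inArcs-cut-empty ab (j , i) (ji , i∈ , j∉) with only (cut tree ab) (bwd ji) i∈ j∉
    ... | ≡.refl , ≡.refl = no-two-step tree ab ji

    rootCone⇒cut-nonneg : rootCone T x → (ab : Arc T a b) → 0# ≤ sumOver (side (cut tree ab)) x
    rootCone⇒cut-nonneg x∈C ab = inArcs-empty⇒nonneg {D = T} (side (cut tree ab)) (inArcs-cut-empty ab) x∈C

    cut-nonneg⇒rootCone : Fin m → V∅ x → (∀ {a b} (ab : Arc T a b) → 0# ≤ sumOver (side (cut tree ab)) x) →
                          rootCone T x
    cut-nonneg⇒rootCone {x = x} r x∈V nonneg = flow⇒rootCone F λ ab → nonneg-resp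
      (sumOver-cut F (tail∈ (cut tree ab)) (head∉ (cut tree ab)) (only (cut tree ab)) (no-two-step tree ab))
      (nonneg ab)
      where
      F : Flow T x
      F = connected⇒flow (IsAlternatingTree.connected tree) r x∈V

  incompatible⇒sumOver≈0 : {T T′ : Digraph m} (S : Subset m) → rootCone T x → rootCone T′ x →
    (σ S T ≡ just Sign.+ × σ S T′ ≡ just Sign.-) ⊎ (σ S T ≡ just Sign.- × σ S T′ ≡ just Sign.+) →
    sumOver S x ≈ 0#
  incompatible⇒sumOver≈0 {T = T} {T′} S x∈C x∈C′ (inj₁ (+T , -T′)) = ≤-nonneg⁻¹
    (inArcs-empty⇒nonneg {D = T} S (σ≡+⁻¹ S T +T) x∈C) (outArcs-empty⇒nonpos {D = T′} S (σ≡-⁻¹ S T′ -T′) x∈C′)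
  incompatible⇒sumOver≈0 {T = T} {T′} S x∈C x∈C′ (inj₂ (-T , +T′)) = ≤-nonneg⁻¹
    (inArcs-empty⇒nonneg {D = T′} S (σ≡+⁻¹ S T′ +T′) x∈C′) (outArcs-empty⇒nonpos {D = T} S (σ≡-⁻¹ S T -T) x∈C)

  -- Open sets and connectedness of convex sets

  Positive : Subset m → Pred (Point m) 0ℓ
  Positive S x = 0# ≺ sumOver S x

  Positive-∁⁻¹ : (S : Subset m) (x : Point m) → V∅ x → Positive (∁ S) x → ¬ 0# ≤ sumOver S x
  Positive-∁⁻¹ S x x∈V p q = pos-nonneg⁻¹ p
    (nonneg-resp (trans (sym (neg-involutive _)) (-‿cong (sym (sumOver-∁ S x∈V)))) q)

  -- K is the size of S and the radius is ρ = s / (1 + K): lowering K coordinates by at most ρ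
  -- leaves at least s - Kρ = ρ.
  isOpen-Positive : (S : Subset m) → IsOpen (Positive S)
  isOpen-Positive {m} S {x} s>0 = from (pos-inverse 1+K>0)
    where
    s K : Carrier
    s = sumOver S x
    K = sum (χ S)
    1+K>0 : 0# ≺ 1# + K
    1+K>0 = pos-+ pos-1 (∑-nonneg (χ S) λ i → []-nonneg (i ∈? S))
    from : ∃[ r ] 0# ≺ r × (1# + K) * r ≈ 1# → ∃[ ρ ] 0# ≺ ρ × Cube x ρ ⊆ Positive S
    from (r , r>0 , Kr≈1) = ρ , ρ>0 , λ {y} near → pos-resp (bound y) (pos-+ ρ>0
      (∑-nonneg _ λ i → *-nonneg ([]-nonneg (i ∈? S)) (≤⇒nonneg (proj₁ (proj₁ (near i))))))
      where
      ρ : Carrier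
      ρ = s * r
      ρ>0 : 0# ≺ ρ
      ρ>0 = pos-* s>0 r>0
      bound : ∀ y → ρ + ∑[ i < m ] (χ S i * (y i - (x i - ρ))) ≈ sumOver S y
      bound y = begin
        ρ + ∑[ i < m ] (χ S i * (y i - (x i - ρ)))
          ≈⟨ +-congˡ (sum-cong-≋ λ i → solve 4 (λ c y x ρ → c :* (y :- (x :- ρ)) := (c :* y :- c :* x) :+ ρ :* c)
               refl (χ S i) (y i) (x i) ρ) ⟩
        ρ + ∑[ i < m ] ((χ S i * y i - χ S i * x i) + ρ * χ S i)
          ≈⟨ +-congˡ (∑-distrib-+ (λ i → χ S i * y i - χ S i * x i) (λ i → ρ * χ S i)) ⟩
        ρ + (∑[ i < m ] (χ S i * y i - χ S i * x i) + ∑[ i < m ] (ρ * χ S i))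
          ≈⟨ +-congˡ (+-cong (∑-distrib-- (λ i → χ S i * y i) (λ i → χ S i * x i)) (sym (*-distribˡ-sum ρ (χ S)))) ⟩
        ρ + ((∑[ i < m ] (χ S i * y i) - ∑[ i < m ] (χ S i * x i)) + ρ * K)
          ≈⟨ +-congˡ (+-congʳ (+-cong (sumOver-χ S y) (-‿cong (sumOver-χ S x)))) ⟨
        ρ + ((sumOver S y - s) + ρ * K)
          ≈⟨ solve 4 (λ s r K Y → s :* r :+ ((Y :- s) :+ (s :* r) :* K) := Y :+ s :* ((con (1 , 0) :+ K) :* r :- con (1 , 0)))
               refl s r K (sumOver S y) ⟩
        sumOver S y + s * ((1# + K) * r - 1#)
          ≈⟨ +-congˡ (*-congˡ (trans (+-congʳ Kr≈1) (-‿inverseʳ 1#))) ⟩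
        sumOver S y + s * 0#
          ≈⟨ trans (+-congˡ (zeroʳ s)) (+-identityʳ _) ⟩
        sumOver S y ∎

  ∈-Cube : (x y : Point m) {ρ : Carrier} → 0# ≺ ρ → (∀ i → x i ≈ y i) → Cube x ρ y
  ∈-Cube x y {ρ} ρ>0 x≈y i =
    pos⇒≺ (pos-resp (trans (solve 2 (λ x ρ → ρ := x :- (x :- ρ)) refl (x i) ρ) (+-congʳ (x≈y i))) ρ>0) ,
    pos⇒≺ (pos-resp (trans (solve 2 (λ x ρ → ρ := (x :+ ρ) :- x) refl (x i) ρ) (+-congˡ (-‿cong (x≈y i)))) ρ>0)

  -- Predicates on points need not respect the setoid equality; open ones do, since every cube
  -- around x contains the points equal to x.
  open-resp : {U : Pred (Point m) 0ℓ} → IsOpen U → (∀ i → x i ≈ y i) → U x → U y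
  open-resp {x = x} {y} U-open x≈y Ux with U-open Ux
  ... | ρ , ρ>0 , near = near (∈-Cube x y ρ>0 x≈y)

  segment : Point m → Point m → Carrier → Point m
  segment x y t i = (1# - t) * x i + t * y i

  Convex : Pred (Point m) 0ℓ → Set
  Convex X = ∀ {x y t} → X x → X y → 0# ≤ t → t ≤ 1# → X (segment x y t)

  absoluteBound : ∀ v → ∃[ d ] 0# ≤ d × 0# ≤ d + v × 0# ≤ d - v
  absoluteBound v with ≤.total 0# v
  ... | inj₁ 0≤v = v , 0≤v , nonneg-+ 0≤v 0≤v , ≤.reflexive (sym (-‿inverseʳ v))
  ... | inj₂ v≤0 = - v , 0≤-v , ≤.reflexive (sym (-‿inverseˡ v)) , nonneg-+ 0≤-v 0≤-v
    where
    0≤-v : 0# ≤ - v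
    0≤-v = nonpos⇒nonneg-neg v≤0

  -- This is τv ≤ δd for |τ| ≤ δ and |v| ≤ d, read off from (δ - τ)(d + v) + (δ + τ)(d - v) = 2(δd -
  -- τv).
  product-bound : ∀ {δ d τ v} → 0# ≤ δ - τ → 0# ≤ δ + τ → 0# ≤ d + v → 0# ≤ d - v → 0# ≤ δ * d - τ * v
  product-bound {δ} {d} {τ} {v} p q r s = *-cancelˡ-nonneg (pos-+ pos-1 nonneg-1) (nonneg-resp
    (solve 4 (λ δ d τ v → (δ :- τ) :* (d :+ v) :+ (δ :+ τ) :* (d :- v) :=
      (con (1 , 0) :+ con (1 , 0)) :* (δ :* d :- τ :* v)) refl δ d τ v)
    (nonneg-+ (*-nonneg p r) (*-nonneg q s)))

  segment-continuous : {U : Pred (Point m) 0ℓ} → IsOpen U → ∀ {s} → U (segment x y s) →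
    ∃[ δ ] 0# ≺ δ × (∀ t → s - δ ≤ t → t ≤ s + δ → U (segment x y t))
  segment-continuous {m} {x} {y} {U} U-open {s} Us = from (U-open Us)
    where
    v d : Fin m → Carrier
    v i = y i - x i
    d i = proj₁ (absoluteBound (v i))
    d≥0 : ∀ i → 0# ≤ d i
    d≥0 i = proj₁ (proj₂ (absoluteBound (v i)))
    from : ∃[ ρ ] 0# ≺ ρ × Cube (segment x y s) ρ ⊆ U →
           ∃[ δ ] 0# ≺ δ × (∀ t → s - δ ≤ t → t ≤ s + δ → U (segment x y t))
    from (ρ , ρ>0 , near) = scaled (pos-inverse (pos-+ pos-1 (∑-nonneg d d≥0)))
      where
      B : Carrier
      B = 1# + sum d
      scaled : ∃[ r ] 0# ≺ r × B * r ≈ 1# →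
               ∃[ δ ] 0# ≺ δ × (∀ t → s - δ ≤ t → t ≤ s + δ → U (segment x y t))
      scaled (r , r>0 , Br≈1) = δ , δ>0 , λ t s-δ≤t t≤s+δ → near λ i →
        let τ = t - s
            0≤δ-τ = nonneg-resp (solve 3 (λ s δ t → (s :+ δ) :- t := δ :- (t :- s)) refl s δ t) (≤⇒nonneg t≤s+δ)
            0≤δ+τ = nonneg-resp (solve 3 (λ s δ t → t :- (s :- δ) := δ :+ (t :- s)) refl s δ t) (≤⇒nonneg s-δ≤t)
            (_ , _ , 0≤d+v , 0≤d-v) = absoluteBound (v i)
        in pos⇒≺ (pos-resp
             (solve 6 (λ ρ δd x y s t → (ρ :- δd) :+ (δd :- (:- (t :- s)) :* (y :- x)) :=
               ((con (1 , 0) :- t) :* x :+ t :* y) :- (((con (1 , 0) :- s) :* x :+ s :* y) :- ρ))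
               refl ρ (δ * d i) (x i) (y i) s t)
             (pos-+ (gap i) (product-bound
               (nonneg-resp (solve 2 (λ δ τ → δ :+ τ := δ :- (:- τ)) refl δ τ) 0≤δ+τ) 0≤δ-τ 0≤d+v 0≤d-v))) ,
           pos⇒≺ (pos-resp
             (solve 6 (λ ρ δd x y s t → (ρ :- δd) :+ (δd :- (t :- s) :* (y :- x)) :=
               (((con (1 , 0) :- s) :* x :+ s :* y) :+ ρ) :- ((con (1 , 0) :- t) :* x :+ t :* y))
               refl ρ (δ * d i) (x i) (y i) s t)
             (pos-+ (gap i) (product-bound 0≤δ-τ 0≤δ+τ 0≤d+v 0≤d-v)))
        where
        δ : Carrier
        -- Dividing ρ by 1 plus the sum of all `d i` gives `δ * d i` below ρ in every coordinate,
        -- strictly because of the 1.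
        δ = ρ * r
        δ>0 : 0# ≺ δ
        δ>0 = pos-* ρ>0 r>0
        δB≈ρ : δ * B ≈ ρ
        δB≈ρ = trans (solve 3 (λ ρ r B → ρ :* r :* B := ρ :* (B :* r)) refl ρ r B) (trans (*-congˡ Br≈1) (*-identityʳ ρ))
        gap : ∀ i → 0# ≺ ρ - δ * d i
        gap i = pos-resp (trans
          (solve 3 (λ δ D d → δ :+ δ :* (D :- d) := δ :* (con (1 , 0) :+ D) :- δ :* d) refl δ (sum d) (d i))
          (+-congʳ δB≈ρ))
          (pos-+ δ>0 (*-nonneg (proj₁ δ>0) (≤⇒nonneg (≤-sum d d≥0 i))))

  segment-0 : (x y : Point m) (i : Fin m) → x i ≈ segment x y 0# i
  segment-0 x y i = solve 2 (λ x y → x := (con (1 , 0) :- con (0 , 0)) :* x :+ con (0 , 0) :* y) refl (x i) (y i)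

  segment-1 : (x y : Point m) {t : Carrier} → t ≈ 1# → (i : Fin m) → segment x y t i ≈ y i
  segment-1 x y {t} t≈1 i = trans (+-cong (*-congʳ (+-congˡ (-‿cong t≈1))) (*-congʳ t≈1))
    (solve 2 (λ x y → (con (1 , 0) :- con (1 , 0)) :* x :+ con (1 , 0) :* y := y) refl (x i) (y i))

  -- The last parameter t with segment t ∈ U can lie neither in U nor in W.
  convex⇒connected : {X : Pred (Point m) 0ℓ} → Convex X → IsConnected X
  convex⇒connected {X = X} convex U W U-open W-open cover (x , Xx , Ux) (y , Xy , Wy) =
    by-contradiction λ disjoint → clash disjoint (supremum P (0# , 0∈P) (1# , λ _ → proj₁ ∘ proj₂))
    where
    P : Pred Carrier 0ℓ
    P t = 0# ≤ t × t ≤ 1# × U (segment x y t)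
    0∈P : P 0#
    0∈P = ≤.refl , nonneg-1 , open-resp U-open (segment-0 x y) Ux
    clash : ¬ (X ≬ (U ∩ W)) → ¬ (∃[ s ] UpperBound P s × (∀ b → UpperBound P b → s ≤ b))
    clash disjoint (s , upper , least) = cases (cover (convex Xx Xy 0≤s s≤1))
      where
      0≤s : 0# ≤ s
      0≤s = upper 0# 0∈P
      s≤1 : s ≤ 1#
      s≤1 = least 1# λ _ → proj₁ ∘ proj₂
      ¬-pos : ∀ {t c} → 0# ≺ c → t + c ≤ t → ⊥
      ¬-pos {t} {c} c>0 p = pos-nonneg⁻¹ c>0 (nonneg-resp (solve 2 (λ t c → t :- (t :+ c) := :- c) refl t c) (≤⇒nonneg p))
      cases : U (segment x y s) ⊎ W (segment x y s) → ⊥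
      cases (inj₁ Us) = beyond (decide (s ≈ 1#)) (segment-continuous U-open Us)
        where
        beyond : Dec (s ≈ 1#) → ∃[ δ ] 0# ≺ δ × (∀ t → s - δ ≤ t → t ≤ s + δ → U (segment x y t)) → ⊥
        -- At the end of the segment there is no room to advance, but there the point is y, which
        -- lies in W.
        beyond (yes s≈1) _ = disjoint (y , Xy , open-resp U-open (segment-1 x y s≈1) Us , Wy)
        beyond (no s≉1) (δ , δ>0 , near) = advance (pos-minimum δ>0 (≺⇒pos (s≤1 , s≉1)))
          where
          advance : ∃[ c ] 0# ≺ c × c ≤ δ × c ≤ 1# - s → ⊥
          advance (c , c>0 , c≤δ , c≤1-s) = ¬-pos c>0 (upper (s + c)
            ( nonneg-+ 0≤s (proj₁ c>0)
            , nonneg⇒≤ (nonneg-resp (solve 3 (λ u s c → (u :- s) :- c := u :- (s :+ c)) refl 1# s c) (≤⇒nonneg c≤1-s))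
            , near (s + c)
                (nonneg⇒≤ (nonneg-resp (solve 3 (λ s c δ → c :+ δ := (s :+ c) :- (s :- δ)) refl s c δ)
                  (nonneg-+ (proj₁ c>0) (proj₁ δ>0))))
                (nonneg⇒≤ (nonneg-resp (solve 3 (λ s c δ → δ :- c := (s :+ δ) :- (s :+ c)) refl s c δ)
                  (≤⇒nonneg c≤δ)))))
      cases (inj₂ Ws) = before (segment-continuous W-open Ws)
        where
        before : ∃[ δ ] 0# ≺ δ × (∀ t → s - δ ≤ t → t ≤ s + δ → W (segment x y t)) → ⊥
        before (δ , δ>0 , near) = ¬-pos δ>0 (≤-resp refl
          (solve 2 (λ s δ → s :- δ :+ δ := s) refl s δ) (+-monoˡ-≤ δ (least (s - δ) bound)))
          where
          -- A parameter of P beyond `s - δ` would give a point of both U and W, so s would not be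
          -- least.
          bound : UpperBound P (s - δ)
          bound t (0≤t , t≤1 , Ut) with ≤.total t (s - δ)
          ... | inj₁ p = p
          ... | inj₂ p = contradiction
            (segment x y t , convex Xx Xy 0≤t t≤1 , Ut , near t p (≤.trans (upper t (0≤t , t≤1 , Ut))
              (nonneg⇒≤ (nonneg-resp (solve 2 (λ s δ → δ := (s :+ δ) :- s) refl s δ) (proj₁ δ>0)))))
            disjoint

  -- Chambers as sign cells

  pos-convex : ∀ {p q t} → 0# ≺ p → 0# ≺ q → 0# ≤ t → t ≤ 1# → 0# ≺ (1# - t) * p + t * q
  pos-convex {p} {q} {t} p>0 q>0 0≤t t≤1 with pos-minimum p>0 q>0
  -- The common lower bound c of p and q also bounds the combination, whether or not t is an
  -- endpoint.
  ... | c , c>0 , c≤p , c≤q = pos-resp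
    (solve 4 (λ c t p q → c :+ ((con (1 , 0) :- t) :* (p :- c) :+ t :* (q :- c)) := (con (1 , 0) :- t) :* p :+ t :* q)
      refl c t p q)
    (pos-+ c>0 (nonneg-+ (*-nonneg (≤⇒nonneg t≤1) (≤⇒nonneg c≤p)) (*-nonneg 0≤t (≤⇒nonneg c≤q))))

  -- Only positive sums are prescribed; applied to complements, the condition fixes the negative
  -- ones as well. The elements a and b say that S is nonempty and proper.
  cell : Point m → Pred (Point m) 0ℓ
  cell x y = V∅ y × (∀ S {a b} → a ∈ S → b ∉ S → Positive S x → Positive S y)

  generic⇒sign : (S : Subset m) (x : Point m) → resonanceComplement x → a ∈ S → b ∉ S → Positive S x ⊎ Positive (∁ S) x
  generic⇒sign S x generic a∈S b∉S with trichotomy (sumOver S x)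
  ... | inj₁ p        = inj₁ p
  ... | inj₂ (inj₁ p) = contradiction p (generic⇒sumOver≉0 {x = x} generic a∈S b∉S)
  ... | inj₂ (inj₂ p) = inj₂ (pos-resp (sym (sumOver-∁ S (proj₁ generic))) p)

  cell⊆resonanceComplement : (x : Point m) → resonanceComplement x → cell x ⊆ resonanceComplement
  cell⊆resonanceComplement x generic {y} (y∈V , signs) = y∈V , λ
    { (S , (a , a∈S) , (_ , b , _ , b∉S) , (_ , sum≈0)) → clash S a∈S b∉S sum≈0 (generic⇒sign S x generic a∈S b∉S) }
    where
    clash : ∀ S {a b} → a ∈ S → b ∉ S → sumOver S y ≈ 0# → ¬ (Positive S x ⊎ Positive (∁ S) x)
    clash S a∈S b∉S sum≈0 (inj₁ p) = pos⇒≉0 (signs S a∈S b∉S p) sum≈0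
    clash S a∈S b∉S sum≈0 (inj₂ p) = pos⇒≉0 (signs (∁ S) (x∉p⇒x∈∁p b∉S) (x∈p⇒x∉∁p a∈S) p)
      (trans (sumOver-∁ S y∈V) (trans (-‿cong sum≈0) (solve 0 (:- con (0 , 0) := con (0 , 0)) refl)))

  cell-convex : (x : Point m) → Convex (cell x)
  cell-convex x {y} {z} {t} (y∈V , y-signs) (z∈V , z-signs) 0≤t t≤1 =
    trans (∑-linear (1# - t) t y z) (trans (+-cong (*-congˡ y∈V) (*-congˡ z∈V))
      (solve 1 (λ t → (con (1 , 0) :- t) :* con (0 , 0) :+ t :* con (0 , 0) := con (0 , 0)) refl t)) ,
    λ S a∈S b∉S p → pos-resp (sym (sumOver-linear S (1# - t) t y z))
      (pos-convex (y-signs S a∈S b∉S p) (z-signs S a∈S b∉S p) 0≤t t≤1)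

  module _ {R : Pred (Point (suc n)) 0ℓ} (chamber : IsChamber n R) where

    chamber⇒generic : ∀ x → R x → resonanceComplement x
    chamber⇒generic x = proj₁ (proj₂ chamber) {x}

    -- If a sum changed sign on R, the disjoint open sets `Positive S` and `Positive (∁ S)`, which
    -- cover R by genericity, would disconnect it.
    chamber⊆cell : R x → R ⊆ cell x
    chamber⊆cell {x} Rx {y} Ry = proj₁ (chamber⇒generic y Ry) , λ S a∈S b∉S p →
      by-contradiction λ ¬q →
        let (z , Rz , q , r) = proj₁ (proj₂ (proj₂ chamber)) (Positive S) (Positive (∁ S))
              (isOpen-Positive S) (isOpen-Positive (∁ S))
              (λ {z} Rz → generic⇒sign S z (chamber⇒generic z Rz) a∈S b∉S)
              (x , Rx , p) (y , Ry , other S (generic⇒sign S y (chamber⇒generic y Ry) a∈S b∉S) ¬q)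
        in Positive-∁⁻¹ S z (proj₁ (chamber⇒generic z Rz)) r (proj₁ q)
      where
      other : ∀ S → Positive S y ⊎ Positive (∁ S) y → ¬ Positive S y → Positive (∁ S) y
      other S (inj₁ p) ¬p = contradiction p ¬p
      other S (inj₂ p) _  = p

    -- The cell is a connected set of generic points containing R, and a component is maximal among
    -- these.
    cell⊆chamber : R x → cell x ⊆ R
    cell⊆chamber {x} Rx = proj₂ (proj₂ (proj₂ chamber)) (cell x)
      (λ {y} → cell⊆resonanceComplement x (chamber⇒generic x Rx) {y}) (convex⇒connected λ {y} {z} → cell-convex x {y} {z})
      (λ {y} → chamber⊆cell Rx {y})

  -- The cliques `𝐓 R`

  module _ {R : Pred (Point (suc n)) 0ℓ} (chamber : IsChamber n R) where

    -- Membership in a root cone depends only on the signs of cut sums, and these are constant on a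
    -- chamber.
    rootCone-spreads : {T : Digraph (suc n)} → IsAlternatingTree T → ∀ x → R x → rootCone T x → R ⊆ rootCone T
    rootCone-spreads {T} tree x Rx x∈C {y} Ry = cut-nonneg⇒rootCone tree {x = y} zero
      (proj₁ (chamber⇒generic chamber y Ry))
      λ ab → nonneg ab (generic⇒sign (Cut.side (cut tree ab)) x (chamber⇒generic chamber x Rx)
               (Cut.tail∈ (cut tree ab)) (Cut.head∉ (cut tree ab)))
      where
      nonneg : (ab : Arc T a b) → Positive (Cut.side (cut tree ab)) x ⊎ Positive (∁ (Cut.side (cut tree ab))) x →
               0# ≤ sumOver (Cut.side (cut tree ab)) y
      nonneg ab (inj₁ p) = proj₁ (proj₂ (chamber⊆cell chamber {x} Rx {y} Ry) (Cut.side (cut tree ab))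
        (Cut.tail∈ (cut tree ab)) (Cut.head∉ (cut tree ab)) p)
      nonneg ab (inj₂ p) = contradiction (rootCone⇒cut-nonneg tree {x = x} x∈C ab)
        (Positive-∁⁻¹ (Cut.side (cut tree ab)) x (proj₁ (chamber⇒generic chamber x Rx)) p)

    𝐓-clique : IsClique (Γ n) (𝐓 R)
    𝐓-clique = proj₁ , λ { {T} {T′} (_ , R⊆T) (_ , R⊆T′) T≢T′ → T≢T′ , λ { (I , (_ , a∈I) , last∉I , signs) →
      let (x , Rx) = proj₁ chamber in
      generic⇒sumOver≉0 {x = x} (chamber⇒generic chamber x Rx) a∈I last∉I
        (incompatible⇒sumOver≈0 {T = T} {T′} I (R⊆T Rx) (R⊆T′ Rx) signs) } }

    𝐓-separates : R x → (S : Subset (suc n)) → Positive S x → ∃[ T ] 𝐓 R T × Empty (inArcs T S)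
    𝐓-separates {x} Rx S p = from (separatingTree S (chamber⇒generic chamber x Rx) p)
      where
      from : SeparatingTree S x → ∃[ T ] 𝐓 R T × Empty (inArcs T S)
      from (T , tree , x∈C , empty) = T , (tree , rootCone-spreads tree x Rx x∈C) , empty

    -- If a tree T compatible with 𝐓 R had R ⊈ C(T), some arc of T would carry a negative amount at a point of R;
    -- a tree of 𝐓 R separating the two sides of that arc has the opposite sign there.
    𝐓-maximal : ∀ Q → IsClique (Γ n) Q → 𝐓 R ⊆ Q → Q ⊆ 𝐓 R
    𝐓-maximal Q (Q-trees , Q-adjacent) 𝐓⊆Q {T} QT = tree , λ {x} Rx →
      cut-nonneg⇒rootCone tree {x = x} zero (proj₁ (chamber⇒generic chamber x Rx)) λ ab → by-contradiction λ ¬nonneg →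
        refute x Rx ab (pos-resp
          (sym (sumOver-∁ (Cut.side (cut tree ab)) {x} (proj₁ (chamber⇒generic chamber x Rx)))) (¬nonneg⇒neg ¬nonneg))
      where
      tree : IsAlternatingTree T
      tree = Q-trees QT

      compatible : ∀ {T′ s s′} → 𝐓 R T′ → (I : Subset (suc n)) → a ∈ I → fromℕ n ∉ I → s ≢ s′ →
                   σ I T ≡ just s → σ I T′ ≡ just s′ → ⊥
      compatible {T′ = T′} {s} {s′} 𝐓T′ I a∈I last∉I s≢s′ σT σT′ =
        proj₂ (Q-adjacent QT (𝐓⊆Q 𝐓T′) T≢T′) (I , (_ , a∈I) , last∉I , opposite s s′ s≢s′ σT σT′)
        where
        -- Cliques relate distinct trees only; the different signs at I show that these are
        -- distinct.
        T≢T′ : T ≢ T′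
        T≢T′ ≡.refl with ≡.trans (≡.sym σT) σT′
        ... | ≡.refl = s≢s′ ≡.refl
        opposite : ∀ s s′ → s ≢ s′ → σ I T ≡ just s → σ I T′ ≡ just s′ →
          (σ I T ≡ just Sign.+ × σ I T′ ≡ just Sign.-) ⊎ (σ I T ≡ just Sign.- × σ I T′ ≡ just Sign.+)
        opposite Sign.+ Sign.+ ≢ _ _ = contradiction ≡.refl ≢
        opposite Sign.+ Sign.- _ p q = inj₁ (p , q)
        opposite Sign.- Sign.+ _ p q = inj₂ (p , q)
        opposite Sign.- Sign.- ≢ _ _ = contradiction ≡.refl ≢

      refute : ∀ x → R x → (ab : Arc T a b) → ¬ Positive (∁ (Cut.side (cut tree ab))) x
      refute {a} {b} x Rx ab negative = from (𝐓-separates {x} Rx (∁ I) negative)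
        where
        I : Subset (suc n)
        I = Cut.side (cut tree ab)
        a∈I : a ∈ I
        a∈I = Cut.tail∈ (cut tree ab)
        b∉I : b ∉ I
        b∉I = Cut.head∉ (cut tree ab)
        x∈V : V∅ x
        x∈V = proj₁ (chamber⇒generic chamber x Rx)
        from : ¬ (∃[ T′ ] 𝐓 R T′ × Empty (inArcs T′ (∁ I)))
        -- Signs are compared on sets without the last vertex: on I if it lies outside I, otherwise
        -- on the complement.
        from (T′ , 𝐓T′ , empty) with fromℕ n ∈? I
        ... | no  last∉I = compatible 𝐓T′ I a∈I last∉I (λ ())
          (σ≡+ I T (inArcs-cut-empty tree ab))
          -- Some arc of `T′` enters I, since otherwise the sum over I would be nonnegative at x.
          (σ≡- I T′ (λ in-empty → Positive-∁⁻¹ I x x∈V negative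
              (inArcs-empty⇒nonneg {D = T′} I in-empty (proj₂ 𝐓T′ Rx)))
            (inArcs-∁ {T = T′} I empty))
        ... | yes last∈I = compatible 𝐓T′ (∁ I) (x∉p⇒x∈∁p b∉I) (x∈p⇒x∉∁p last∈I) (λ ())
          (σ≡- (∁ I) T (λ in-empty → in-empty (a , b) (ab , x∉p⇒x∈∁p b∉I , x∈p⇒x∉∁p a∈I))
            λ { (i , j) (ij , i∈∁I , j∉∁I) →
              inArcs-cut-empty tree ab (i , j) (ij , x∉∁p⇒x∈p j∉∁I , x∈∁p⇒x∉p i∈∁I) })
          (σ≡+ (∁ I) T′ empty)

  -- For each sum positive at a point of R, a separating tree of R also contains `R′` in its cone,
  -- so the sum is nonnegative on `R′`, and positive by genericity. Thus `R′` lies in the sign cell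
  -- of R.
  𝐓-antitone : {R R′ : Pred (Point (suc n)) 0ℓ} → IsChamber n R → IsChamber n R′ → 𝐓 R ⊆ 𝐓 R′ → R′ ⊆ R
  𝐓-antitone {n} {R} {R′} chamber chamber′ 𝐓⊆𝐓′ {y} R′y = from (proj₁ chamber)
    where
    from : Satisfiable R → R y
    from (x , Rx) = cell⊆chamber chamber {x} Rx (proj₁ (chamber⇒generic chamber′ y R′y) , positive)
      where
      positive : ∀ S {a b} → a ∈ S → b ∉ S → Positive S x → Positive S y
      positive S a∈S b∉S p = via (𝐓-separates chamber {x} Rx S p)
        where
        via : ∃[ T ] 𝐓 R T × Empty (inArcs T S) → Positive S y
        via (T , 𝐓T , empty) =
          inArcs-empty⇒nonneg {D = T} S empty (proj₂ (𝐓⊆𝐓′ 𝐓T) R′y) ,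
          λ 0≈ → generic⇒sumOver≉0 {x = y} (chamber⇒generic chamber′ y R′y) a∈S b∉S (sym 0≈)

  𝐓-injective : {R R′ : Pred (Point (suc n)) 0ℓ} → IsChamber n R → IsChamber n R′ → 𝐓 R ≐ 𝐓 R′ → R ≐ R′
  𝐓-injective chamber chamber′ (to , from) =
    (λ {x} → 𝐓-antitone chamber′ chamber from {x}) , (λ {x} → 𝐓-antitone chamber chamber′ to {x})

  𝐓-resp : {R R′ : Pred (Point m) 0ℓ} → R ≐ R′ → 𝐓 R ≐ 𝐓 R′
  𝐓-resp (to , from) = (λ (tree , p) → tree , λ R′x → p (from R′x)) , (λ (tree , p) → tree , λ Rx → p (to Rx))

  -- The image is taken up to `≐`, the equality of `Subsets`; maximality is transported along it.
  𝐓-image : ∀ n → Pred (Pred (Digraph (suc n)) 0ℓ) (lsuc 0ℓ)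
  𝐓-image n Q = ∃[ R ] IsChamber n R × Q ≐ 𝐓 R

  𝐓-image⊆maximalCliques : ∀ n {Q} → 𝐓-image n Q → IsMaximalClique (Γ n) Q
  𝐓-image⊆maximalCliques n (R , chamber , Q≐𝐓) =
    maximalClique-resp (Γ n) (≐-sym Q≐𝐓) (𝐓-clique chamber , 𝐓-maximal chamber)

  𝐓-bijection : ∀ n → Bijection (Subsets (IsChamber n)) (Subsets (𝐓-image n))
  𝐓-bijection n = record
    { to        = λ (R , chamber) → 𝐓 R , R , chamber , ≐-refl
    ; cong      = λ R≐R′ → 𝐓-resp R≐R′
    ; bijective = (λ {R} {R′} → 𝐓-injective (proj₂ R) (proj₂ R′)) ,
                  (λ (Q , R , chamber , Q≐𝐓) → (R , chamber) , λ R′≐R → ≐-trans (𝐓-resp R′≐R) (≐-sym Q≐𝐓))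
    }

  -- Interiors of full-dimensional cone intersections

  rootCone-+ : {T : Digraph m} → rootCone T x → rootCone T y → rootCone T (λ i → 1# * x i + 1# * y i)
  rootCone-+ {x = x} {y} {T} x∈C y∈C = from (rootCone⇒flow {D = T} x∈C) (rootCone⇒flow {D = T} y∈C)
    where
    from : Σ (Flow T x) Nonnegative → Σ (Flow T y) Nonnegative → rootCone T (λ i → 1# * x i + 1# * y i)
    from (F , F≥0) (G , G≥0) = flow⇒rootCone (flow-linear 1# 1# F G) λ {i} {j} _ →
      nonneg-+ (*-nonneg nonneg-1 (F≥0 i j)) (*-nonneg nonneg-1 (G≥0 i j))

  sumOver-affine-zero : (S : Subset m) (c : Fin k → Carrier) (p : Fin k → Point m) →
    (∀ j → sumOver S (p j) ≈ 0#) → sumOver S (λ i → ∑[ j < k ] (c j * p j i)) ≈ 0#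
  sumOver-affine-zero {m} {zero} S c p p≈0 = trans (sumOver-χ S (λ _ → 0#)) (∑-zero {m} _ λ i → zeroʳ (χ S i))
  sumOver-affine-zero {m} {suc k} S c p p≈0 = begin
    sumOver S (λ i → c zero * p zero i + rest i)
      ≈⟨ sumOver-cong S (λ i → +-congˡ (sym (*-identityˡ (rest i)))) ⟩
    sumOver S (λ i → c zero * p zero i + 1# * rest i)
      ≈⟨ sumOver-linear S (c zero) 1# (p zero) rest ⟩
    c zero * sumOver S (p zero) + 1# * sumOver S rest
      ≈⟨ +-cong (*-congˡ (p≈0 zero)) (*-congˡ (sumOver-affine-zero S (c ∘ suc) (p ∘ suc) (p≈0 ∘ suc))) ⟩
    c zero * 0# + 1# * 0#
      ≈⟨ solve 1 (λ c → c :* con (0 , 0) :+ con (1 , 0) :* con (0 , 0) := con (0 , 0)) refl (c zero) ⟩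
    0# ∎
    where
    rest : Point m
    rest i = ∑[ j < k ] (c (suc j) * p (suc j) i)

  sumOver-root : a ∈ S → b ∉ S → sumOver S (λ k → 1# * e a k + (- 1#) * e b k) ≈ 1#
  sumOver-root {a = a} {S} {b} a∈S b∉S = begin
    sumOver S (λ k → 1# * e a k + (- 1#) * e b k)
      ≈⟨ sumOver-linear S 1# (- 1#) (e a) (e b) ⟩
    1# * sumOver S (e a) + (- 1#) * sumOver S (e b)
      ≈⟨ +-cong (*-congˡ (trans (sumOver-e S a) ([]-yes (a ∈? S) a∈S)))
                (*-congˡ (trans (sumOver-e S b) ([]-no (b ∈? S) b∉S))) ⟩
    1# * 1# + (- 1#) * 0#
      ≈⟨ solve 0 (con (1 , 0) :* con (1 , 0) :+ (:- con (1 , 0)) :* con (0 , 0) := con (1 , 0)) refl ⟩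
    1# ∎

  V∅-linear : (s t : Carrier) (x y : Point m) → V∅ x → V∅ y → V∅ (λ i → s * x i + t * y i)
  V∅-linear s t x y x∈V y∈V = trans (∑-linear s t x y) (trans (+-cong (*-congˡ x∈V) (*-congˡ y∈V))
    (solve 2 (λ s t → s :* con (0 , 0) :+ t :* con (0 , 0) := con (0 , 0)) refl s t))

  V∅-root : (a b : Fin m) → V∅ (λ k → 1# * e a k + (- 1#) * e b k)
  V∅-root a b = trans (∑-linear 1# (- 1#) (e a) (e b)) (trans
    (+-cong (*-congˡ (sum-e a)) (*-congˡ (sum-e b)))
    (solve 0 (con (1 , 0) :* con (1 , 0) :+ (:- con (1 , 0)) :* con (1 , 0) := con (0 , 0)) refl))

  module _ {𝒮 : Pred (Digraph (suc n)) 0ℓ} (trees : 𝒮 ⊆ (IsAlternatingTree ∩ IsPositive))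
           (full : IsFullDimensional (coneIntersection 𝒮)) where

    X : Pred (Point (suc n)) 0ℓ
    X = coneIntersection 𝒮

    -- Indexed by subsets rather than by the trees of 𝒮, so that finiteness is immediate; the cut
    -- inequalities of all these trees are included.
    Constraint : Pred (Subset (suc n)) 0ℓ
    Constraint S = (∃[ a ] a ∈ S) × (∃[ b ] b ∉ S) × (∀ x → X x → 0# ≤ sumOver S x)

    -- A sum vanishing on all of X would vanish on its affine hull, which contains a root with sum
    -- 1.
    strict : ∀ S → Constraint S → ∃[ x ] X x × Positive S x
    strict S ((a , a∈S) , (b , b∉S) , nonneg) = by-contradiction λ none →
      contradict none (full {λ k → 1# * e a k + (- 1#) * e b k} (V∅-root a b))
      where
      contradict : ¬ (∃[ x ] X x × Positive S x) → ¬ affineHull X (λ k → 1# * e a k + (- 1#) * e b k)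
      contradict none (k , p , c , p∈X , _ , expand) = 0≉1 (sym (begin
        1#
          ≈⟨ sumOver-root a∈S b∉S ⟨
        sumOver S (λ k → 1# * e a k + (- 1#) * e b k)
          ≈⟨ sumOver-cong S expand ⟩
        sumOver S (λ i → ∑[ j < k ] (c j * p j i))
          ≈⟨ sumOver-affine-zero S c p (λ j → ≤-nonneg⁻¹ (nonneg (p j) (p∈X j))
               (¬pos⇒nonneg-neg λ pos → none (p j , p∈X j , pos))) ⟩
        0# ∎))

    X-+ : X x → X y → X (λ i → 1# * x i + 1# * y i)
    X-+ {x} {y} (x∈V , x∈C) (y∈V , y∈C) =
      V∅-linear 1# 1# x y x∈V y∈V , λ T 𝒮T → rootCone-+ {x = x} {y} {T} (x∈C T 𝒮T) (y∈C T 𝒮T)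

    X-0 : X (λ _ → 0#)
    X-0 = ∑-zero {suc n} _ (λ _ → refl) ,
      λ T _ → flow⇒rootCone (flow-zero {D = T}) (λ _ → ≤.refl)

    strictPoint : ∃[ z ] X z × (∀ S → Constraint S → Positive S z)
    strictPoint = directed⇒uniform X (λ S z → Constraint S → Positive S z) directed pointwise
      where
      directed : ∀ {p q} → X p → X q → ∃[ r ] X r ×
        (∀ S → (Constraint S → Positive S p) → Constraint S → Positive S r) ×
        (∀ S → (Constraint S → Positive S q) → Constraint S → Positive S r)
      directed {p} {q} Xp Xq = (λ i → 1# * p i + 1# * q i) , X-+ Xp Xq ,
        (λ S strict-p c → pos-resp
          (trans (+-cong (sym (*-identityˡ _)) (sym (*-identityˡ _))) (sym (sumOver-linear S 1# 1# p q)))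
          (pos-+ (strict-p c) (proj₂ (proj₂ c) q Xq))) ,
        (λ S strict-q c → pos-resp
          (trans (+-comm _ _)
            (trans (+-cong (sym (*-identityˡ _)) (sym (*-identityˡ _))) (sym (sumOver-linear S 1# 1# p q))))
          (pos-+ (strict-q c) (proj₂ (proj₂ c) p Xp)))
      pointwise : ∀ S → ∃[ z ] X z × (Constraint S → Positive S z)
      pointwise S = cases (decide (Constraint S))
        where
        cases : Dec (Constraint S) → ∃[ z ] X z × (Constraint S → Positive S z)
        cases (no ¬c) = (λ _ → 0#) , X-0 , λ c → contradiction c ¬c
        cases (yes c) = let (z , Xz , pos) = strict S c in z , Xz , λ _ → pos

    -- Around a point where all constraints are strict, one cube keeps them all positive, and the
    -- cut inequalities among them put its points of `V∅` into every cone.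
    interior-nonempty : Satisfiable (interior X)
    interior-nonempty = from strictPoint
      where
      from : ∃[ z ] X z × (∀ S → Constraint S → Positive S z) → Satisfiable (interior X)
      from (z , (z∈V , _) , positive) = z , z∈V , ball
        (directed⇒uniform (0# ≺_) (λ S ρ → Constraint S → Cube z ρ ⊆ Positive S) directed pointwise)
        where
        shrinkCube : ∀ {δ ρ} → δ ≤ ρ → Cube z δ ⊆ Cube z ρ
        shrinkCube {δ} {ρ} δ≤ρ {y} near i =
          ≤-≺-trans (nonneg⇒≤ (nonneg-resp
            (solve 3 (λ z δ ρ → ρ :- δ := (z :- δ) :- (z :- ρ)) refl (z i) δ ρ) (≤⇒nonneg δ≤ρ))) (proj₁ (near i)) ,
          pos⇒≺ (pos-resp (solve 4 (λ z y δ ρ → ((z :+ δ) :- y) :+ (ρ :- δ) := (z :+ ρ) :- y) refl (z i) (y i) δ ρ)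
            (pos-+ (≺⇒pos (proj₂ (near i))) (≤⇒nonneg δ≤ρ)))
        directed : ∀ {p q} → 0# ≺ p → 0# ≺ q → ∃[ r ] 0# ≺ r ×
          (∀ S → (Constraint S → Cube z p ⊆ Positive S) → Constraint S → Cube z r ⊆ Positive S) ×
          (∀ S → (Constraint S → Cube z q ⊆ Positive S) → Constraint S → Cube z r ⊆ Positive S)
        directed p>0 q>0 with pos-minimum p>0 q>0
        ... | r , r>0 , r≤p , r≤q = r , r>0 ,
          (λ S ⊆p c {y} near → ⊆p c {y} (shrinkCube r≤p {y} near)) ,
          (λ S ⊆q c {y} near → ⊆q c {y} (shrinkCube r≤q {y} near))
        pointwise : ∀ S → ∃[ ρ ] 0# ≺ ρ × (Constraint S → Cube z ρ ⊆ Positive S)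
        pointwise S = cases (decide (Constraint S))
          where
          cases : Dec (Constraint S) → ∃[ ρ ] 0# ≺ ρ × (Constraint S → Cube z ρ ⊆ Positive S)
          cases (no ¬c) = 1# , pos-1 , λ c → contradiction c ¬c
          cases (yes c) = let (ρ , ρ>0 , near) = isOpen-Positive S {z} (positive S c) in ρ , ρ>0 , λ _ → near
        ball : ∃[ ρ ] 0# ≺ ρ × (∀ S → Constraint S → Cube z ρ ⊆ Positive S) →
               ∃[ ρ ] 0# ≺ ρ × (V∅ ∩ Cube z ρ) ⊆ X
        ball (ρ , ρ>0 , near) = ρ , ρ>0 , λ {y} (y∈V , y-near) → y∈V , λ T 𝒮T →
          let tree = proj₁ (trees 𝒮T) in cut-nonneg⇒rootCone tree {x = y} zero y∈V λ ab → proj₁ (near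
            (Cut.side (cut tree ab))
            ((_ , Cut.tail∈ (cut tree ab)) , (_ , Cut.head∉ (cut tree ab)) ,
              λ x x∈X → rootCone⇒cut-nonneg tree {x = x} (proj₂ x∈X T 𝒮T) ab)
            {y} y-near)

  -- Openness of interiors and the cliques `𝐓⁺ K`

  half : ∀ {ρ} → 0# ≺ ρ → ∃[ δ ] 0# ≺ δ × δ + δ ≈ ρ
  half {ρ} ρ>0 with pos-inverse (pos-+ pos-1 nonneg-1)
  ... | r , r>0 , 2r≈1 = ρ * r , pos-* ρ>0 r>0 , trans
    (solve 2 (λ ρ r → ρ :* r :+ ρ :* r := ρ :* ((con (1 , 0) :+ con (1 , 0)) :* r)) refl ρ r)
    (trans (*-congˡ 2r≈1) (*-identityʳ ρ))

  interior⊆ : (X : Pred (Point m) 0ℓ) → interior X ⊆ X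
  interior⊆ X {x} (x∈V , ρ , ρ>0 , near) = near (x∈V , ∈-Cube x x ρ>0 λ _ → refl)

  interior-open : (X : Pred (Point m) 0ℓ) → interior X x → ∃[ δ ] 0# ≺ δ ×
    (∀ y → V∅ y → (∀ i → x i - δ ≤ y i × y i ≤ x i + δ) → interior X y)
  interior-open {x = x} X (x∈V , ρ , ρ>0 , near) = from (half ρ>0)
    where
    from : ∃[ δ ] 0# ≺ δ × δ + δ ≈ ρ → ∃[ δ ] 0# ≺ δ ×
      (∀ y → V∅ y → (∀ i → x i - δ ≤ y i × y i ≤ x i + δ) → interior X y)
    from (δ , δ>0 , 2δ≈ρ) = δ , δ>0 , λ y y∈V y-near → y∈V , δ , δ>0 , λ {z} (z∈V , z-near) → near (z∈V , λ i →
      pos⇒≺ (pos-resp (trans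
        (solve 4 (λ x y z δ → (z :- (y :- δ)) :+ (y :- (x :- δ)) := z :- (x :- (δ :+ δ))) refl (x i) (y i) (z i) δ)
        (+-congˡ (-‿cong (+-congˡ (-‿cong 2δ≈ρ)))))
        (pos-+ (≺⇒pos (proj₁ (z-near i))) (≤⇒nonneg (proj₁ (y-near i))))) ,
      pos⇒≺ (pos-resp (trans
        (solve 4 (λ x y z δ → ((y :+ δ) :- z) :+ ((x :+ δ) :- y) := (x :+ (δ :+ δ)) :- z) refl (x i) (y i) (z i) δ)
        (+-congʳ (+-congˡ 2δ≈ρ)))
        (pos-+ (≺⇒pos (proj₂ (z-near i))) (≤⇒nonneg (proj₂ (y-near i))))))

  -- Moving from x by δ along the root from b to a stays in the interior and changes the sum over S
  -- by δ.
  interior⊆hyperplane⇒⊥ : (X : Pred (Point m) 0ℓ) → interior X x → a ∈ S → b ∉ S →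
                          ¬ (∀ y → interior X y → sumOver S y ≈ 0#)
  interior⊆hyperplane⇒⊥ {m} {x} {a} {S} {b} X x∈int a∈S b∉S vanish = from (interior-open X x∈int)
    where
    r : Point m
    r k = 1# * e a k + (- 1#) * e b k
    from : ¬ (∃[ δ ] 0# ≺ δ × (∀ y → V∅ y → (∀ i → x i - δ ≤ y i × y i ≤ x i + δ) → interior X y))
    from (δ , δ>0 , near) = pos⇒≉0 δ>0 (begin
      δ
        ≈⟨ solve 1 (λ δ → δ := con (1 , 0) :* con (0 , 0) :+ δ :* con (1 , 0)) refl δ ⟩
      1# * 0# + δ * 1#
        ≈⟨ +-cong (*-congˡ (vanish x x∈int)) (*-congˡ (sumOver-root a∈S b∉S)) ⟨
      1# * sumOver S x + δ * sumOver S r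
        ≈⟨ sumOver-linear S 1# δ x r ⟨
      sumOver S (λ i → 1# * x i + δ * r i)
        ≈⟨ vanish _ (near _ (V∅-linear 1# δ x r (proj₁ x∈int) (V∅-root a b)) bounds) ⟩
      0# ∎)
      where
      1-e≥0 : ∀ c i → 0# ≤ 1# - e c i
      1-e≥0 c i with c ≟ i
      ... | yes _ = ≤.reflexive (sym (-‿inverseʳ 1#))
      ... | no  _ = nonneg-resp (solve 0 (con (1 , 0) := con (1 , 0) :- con (0 , 0)) refl) nonneg-1
      bounds : ∀ i → x i - δ ≤ 1# * x i + δ * r i × 1# * x i + δ * r i ≤ x i + δ
      bounds i =
        nonneg⇒≤ (nonneg-resp
          (solve 4 (λ x δ p q → δ :* (p :+ (con (1 , 0) :- q)) :=
            (con (1 , 0) :* x :+ δ :* (con (1 , 0) :* p :+ (:- con (1 , 0)) :* q)) :- (x :- δ)) refl (x i) δ (e a i) (e b i))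
          (*-nonneg (proj₁ δ>0) (nonneg-+ ([]-nonneg (a ≟ i)) (1-e≥0 b i)))) ,
        nonneg⇒≤ (nonneg-resp
          (solve 4 (λ x δ p q → δ :* (q :+ (con (1 , 0) :- p)) :=
            (x :+ δ) :- (con (1 , 0) :* x :+ δ :* (con (1 , 0) :* p :+ (:- con (1 , 0)) :* q))) refl (x i) δ (e a i) (e b i))
          (*-nonneg (proj₁ δ>0) (nonneg-+ ([]-nonneg (b ≟ i)) (1-e≥0 a i))))

  -- Incompatible trees would confine K to a hyperplane, although K is a nonempty interior.
  𝐓⁺-clique : {K : Pred (Point (suc n)) 0ℓ} → IsRefinedChamber K → IsClique (Γ⁺ n) (𝐓⁺ K)
  𝐓⁺-clique {n} {K} (𝒮 , trees , full , K⊆int , int⊆K) = proj₁ , λ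
    { {T} {T′} (_ , K⊆T) (_ , K⊆T′) T≢T′ → T≢T′ , λ { (I , (_ , a∈I) , last∉I , signs) →
      interior⊆hyperplane⇒⊥ (coneIntersection 𝒮) (proj₂ (interior-nonempty trees full)) a∈I last∉I
        λ y y∈int → incompatible⇒sumOver≈0 {x = y} {T = T} {T′} I (K⊆T (int⊆K y∈int)) (K⊆T′ (int⊆K y∈int)) signs } }

  -- The family 𝒮 defining K is contained in `𝐓⁺ K`, hence in `𝐓⁺ K′`. So `K′` lies in every cone of
  -- 𝒮 and, being open in `V∅`, in the interior of their intersection.
  𝐓⁺-antitone : {K K′ : Pred (Point (suc n)) 0ℓ} → IsRefinedChamber K → IsRefinedChamber K′ →
                𝐓⁺ K ⊆ 𝐓⁺ K′ → K′ ⊆ K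
  𝐓⁺-antitone {n} {K} {K′} (𝒮 , trees , _ , K⊆int , int⊆K) (𝒮′ , _ , _ , K′⊆int , int⊆K′) 𝐓⁺⊆ {y} K′y =
    int⊆K {y} (from (interior-open (coneIntersection 𝒮′) (K′⊆int {y} K′y)))
    where
    𝒮⊆𝐓⁺ : 𝒮 ⊆ 𝐓⁺ K
    𝒮⊆𝐓⁺ {T} 𝒮T = trees 𝒮T , λ {x} Kx → proj₂ (interior⊆ (coneIntersection 𝒮) {x} (K⊆int {x} Kx)) T 𝒮T
    from : ∃[ δ ] 0# ≺ δ × (∀ z → V∅ z → (∀ i → y i - δ ≤ z i × z i ≤ y i + δ) → interior (coneIntersection 𝒮′) z) →
           interior (coneIntersection 𝒮) y
    from (δ , δ>0 , near) = proj₁ (K′⊆int {y} K′y) , δ , δ>0 , λ {z} (z∈V , z-near) →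
      z∈V , λ T 𝒮T → proj₂ (𝐓⁺⊆ (𝒮⊆𝐓⁺ 𝒮T)) {z}
        (int⊆K′ {z} (near z z∈V λ i → proj₁ (proj₁ (z-near i)) , proj₁ (proj₂ (z-near i))))

  𝐓⁺-injective : {K K′ : Pred (Point (suc n)) 0ℓ} → IsRefinedChamber K → IsRefinedChamber K′ →
                 𝐓⁺ K ≐ 𝐓⁺ K′ → K ≐ K′
  𝐓⁺-injective refined refined′ (to , from) =
    (λ {x} → 𝐓⁺-antitone refined′ refined from {x}) , (λ {x} → 𝐓⁺-antitone refined refined′ to {x})

theorem2 :
  (∀ ℓ → ExcludedMiddle ℓ) →
  (ℝ : CompleteOrderedField) → let open Geometry ℝ in
  (n : ℕ) → .{{_ : NonZero n}} →
  ( (∀ R → IsChamber n R → IsClique (Γ n) (𝐓 R))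
  × (∀ R R′ → IsChamber n R → IsChamber n R′ → 𝐓 R ≐ 𝐓 R′ → R ≐ R′) )
  ×
  ( (∀ K → IsKostantChamber n K → IsClique (Γ⁺ n) (𝐓⁺ K))
  × (∀ K K′ → IsKostantChamber n K → IsKostantChamber n K′ → 𝐓⁺ K ≐ 𝐓⁺ K′ → K ≐ K′) )
  ×
  ( (∀ R → IsChamber n R → IsMaximalClique (Γ n) (𝐓 R))
  × (Σ[ 𝒬 ∈ Pred (Pred (Digraph _) 0ℓ) (lsuc 0ℓ) ]
       𝒬 ⊆ IsMaximalClique (Γ n)
     × (Σ[ φ ∈ Bijection (Subsets (IsChamber n)) (Subsets 𝒬) ]
          (∀ R → proj₁ (Bijection.to φ R) ≐ 𝐓 (proj₁ R)))) )
theorem2 em ℝ n =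
  ( (λ _ → 𝐓-clique)
  , (λ _ _ → 𝐓-injective) )
  ,
  ( (λ _ kostant → 𝐓⁺-clique (proj₁ kostant))
  , (λ _ _ kostant kostant′ → 𝐓⁺-injective (proj₁ kostant) (proj₁ kostant′)) )
  ,
  ( (λ _ chamber → 𝐓-clique chamber , 𝐓-maximal chamber)
  , 𝐓-image n , 𝐓-image⊆maximalCliques n , 𝐓-bijection n , λ _ → ≐-refl )
  where open Chambers em ℝ
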